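{- Let $G=(V,E)$ be a graph and $\mathcal{C}$ a 2-coloring of $G$ with red degree sequence $d$. Then \[\dim\mathcal{A}(G,\mathcal{C})=\#E_d-\#V+b(V,E_d),\] where $b(V,E_d)$ denotes the number of bipartite connected components of the graph $(V,E_d)$.
   Context: Graphs are finite, undirected, may have parallel edges but no loops. A 2-coloring is $\mathcal{C}:E\to\{R,B\}$; its red degree sequence is $d=(d(v):v\in V)$ where $d(v)$ is the number of red edges at $v$. $\mathcal{K}(d)$ is the set of all 2-colorings of $G$ with red degree sequence $d$. The alternating cone $\mathcal{A}(G,\mathcal{C})\subseteq\mathbb{R}^E$ is the set of $x\ge0$ such that at each vertex the sum of $x$ over incident red edges equals the sum over incident blue edges. A closed alternating walk (CAW) is a walk $(v_0,e_1,v_1,\dots,e_m,v_m)$ with $v_0=v_m$, consecutive edges of different colors, and $\mathcal{C}(e_m)\ne\mathcal{C}(e_1)$. $E_d$ is the set of edges $e\in E$ such that some 2-coloring in $\mathcal{K}(d)$ has a CAW containing $e$ (isolated vertices count as bipartite components of $(V,E_d)$). -}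

module Defs where

open import Algebra.Apartness.Bundles using (HeytingField; module HeytingCommutativeRing)
open import Algebra.Bundles using (CommutativeRing)
import Algebra.Definitions.RawMonoid as RawMonoidDefinitions
import Algebra.Properties.CommutativeMonoid.Sum as CommutativeMonoidSum
open import Data.Bool.Base using (Bool; if_then_else_)
open import Data.Fin.Base using (Fin)
open import Data.Fin.Properties using (_≟_)
open import Data.List.Base using (List; []; _∷_; allFin; filter; head; last; length)
open import Data.List.Membership.Propositional using () renaming (_∈_ to _∈ˡ_)
open import Data.List.Relation.Unary.Linked using (Linked)
open import Data.Maybe.Relation.Binary.Connected using (Connected)
open import Data.Nat.Base using (ℕ) renaming (_≤_ to _≤ℕ_)
open import Data.Product.Base using (Σ; ∃; ∃-syntax; _×_; _,_; proj₁; proj₂)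
open import Data.Sum.Base using (_⊎_)
open import Function.Bundles using (Inverse)
open import Level using (Level; 0ℓ; _⊔_) renaming (suc to lsuc)
open import Relation.Binary.Bundles using (Setoid)
open import Relation.Binary.Core using (Rel)
import Relation.Binary.Construct.Closure.Equivalence as EqClosure
import Relation.Binary.Construct.On as On
open import Relation.Binary.Definitions using (DecidableEquality)
open import Relation.Binary.PropositionalEquality using (_≡_; _≢_; refl; setoid)
open import Relation.Binary.Structures using (IsStrictPartialOrder)
open import Relation.Nullary using (¬_; Dec; yes; no; does)
open import Relation.Nullary.Decidable using (_⊎-dec_; _×-dec_)
open import Relation.Unary using (Pred; _∈_)

-- Finite cardinality, of a quotient when the setoid equality is coarser
-- than _≡_.
HasCardinality : ∀ {a ℓ} → Setoid a ℓ → ℕ → Set (a ⊔ ℓ)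
HasCardinality S n = Inverse S (setoid (Fin n))

-- Decidability of _<_ is not assumed, so that the usual constructive reals
-- are an instance; under excluded middle these are the ordered fields.
record OrderedField c ℓ₁ ℓ₂ ℓ₃ : Set (lsuc (c ⊔ ℓ₁ ⊔ ℓ₂ ⊔ ℓ₃)) where
  infix 4 _<_ _≤_
  field
    heytingField : HeytingField c ℓ₁ ℓ₂
  open HeytingField heytingField public
    using (Carrier; _≈_; _#_; _+_; _*_; -_; _-_; 0#; 1#; heytingCommutativeRing)
  field
    _<_                  : Rel Carrier ℓ₃
    isStrictPartialOrder : IsStrictPartialOrder _≈_ _<_
    <⇒#                  : ∀ {x y} → x < y → x # y
    #⇒<⊎>                : ∀ {x y} → x # y → x < y ⊎ y < x
    +-monoˡ-<            : ∀ {x y} z → x < y → x + z < y + z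
    *-pos                : ∀ {x y} → 0# < x → 0# < y → 0# < x * y

  _≤_ : Rel Carrier ℓ₃
  x ≤ y = ¬ (y < x)

  open HeytingCommutativeRing heytingCommutativeRing public using (commutativeRing)
  open CommutativeRing commutativeRing public using (+-commutativeMonoid; +-rawMonoid)
  open CommutativeMonoidSum +-commutativeMonoid public using (sum)

-- The real numbers, characterised as a Cauchy-complete Archimedean ordered
-- field.
record RealNumbers c ℓ₁ ℓ₂ ℓ₃ : Set (lsuc (c ⊔ ℓ₁ ⊔ ℓ₂ ⊔ ℓ₃)) where
  field
    orderedField : OrderedField c ℓ₁ ℓ₂ ℓ₃
  open OrderedField orderedField public

  open RawMonoidDefinitions +-rawMonoid using () renaming (_×_ to _·_)

  -- ∣ x - y ∣ < ε
  Within : Carrier → Carrier → Carrier → Set ℓ₃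
  Within ε x y = (x - y < ε) × (y - x < ε)

  Cauchy : (ℕ → Carrier) → Set (c ⊔ ℓ₃)
  Cauchy s = ∀ ε → 0# < ε →
    ∃[ N ] (∀ m n → N ≤ℕ m → N ≤ℕ n → Within ε (s m) (s n))

  ConvergesTo : (ℕ → Carrier) → Carrier → Set (c ⊔ ℓ₃)
  ConvergesTo s x = ∀ ε → 0# < ε → ∃[ N ] (∀ n → N ≤ℕ n → Within ε (s n) x)

  field
    archimedean : ∀ x → ∃[ n ] (x < n · 1#)
    complete    : ∀ s → Cauchy s → ∃[ x ] ConvergesTo s x

module Dimension {c ℓ₁ ℓ₂ ℓ₃} (ℝ : RealNumbers c ℓ₁ ℓ₂ ℓ₃) {m : ℕ} where
  open RealNumbers ℝ

  private
    Vect : Set c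
    Vect = Fin m → Carrier

  lincomb : ∀ {k} → (Fin k → Carrier) → (Fin k → Vect) → Vect
  lincomb a v e = sum (λ i → a i * v i e)

  _≋_ : Rel Vect ℓ₁
  x ≋ y = ∀ e → x e ≈ y e

  Span : ∀ {p} → Pred Vect p → Pred Vect (c ⊔ ℓ₁ ⊔ p)
  Span P x = ∃[ k ] Σ (Fin k → Carrier) λ a → Σ (Fin k → Vect) λ v →
    (∀ i → v i ∈ P) × (x ≋ lincomb a v)

  LinearlyIndependent : ∀ {k} → (Fin k → Vect) → Set (c ⊔ ℓ₁)
  LinearlyIndependent v =
    ∀ a → (lincomb a v ≋ λ _ → 0#) → ∀ i → a i ≈ 0#

  IsBasisOf : ∀ {k p} → (Fin k → Vect) → Pred Vect p → Set (c ⊔ ℓ₁ ⊔ p)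
  IsBasisOf b S =
    (∀ i → b i ∈ S) × LinearlyIndependent b ×
    (∀ x → x ∈ S → ∃[ a ] (x ≋ lincomb a b))

  -- The dimension of a cone is that of its affine hull, which is its linear
  -- span because a cone contains the origin.
  HasDimension : ∀ {p} → Pred Vect p → ℕ → Set (c ⊔ ℓ₁ ⊔ p)
  HasDimension P k = Σ (Fin k → Vect) λ b → IsBasisOf b (Span P)

-- The order of the two ends of an edge carries no meaning; distinct edges may
-- have the same ends.
record Graph : Set where
  field
    #V #E    : ℕ
    ends     : Fin #E → Fin #V × Fin #V
    loopless : ∀ e → proj₁ (ends e) ≢ proj₂ (ends e)

  V E : Set
  V = Fin #V
  E = Fin #E

  Joins : E → V → V → Set
  Joins e u v = ends e ≡ (u , v) ⊎ ends e ≡ (v , u)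

  Incident : V → E → Set
  Incident v e = v ≡ proj₁ (ends e) ⊎ v ≡ proj₂ (ends e)

  incident? : ∀ v e → Dec (Incident v e)
  incident? v e = (v ≟ proj₁ (ends e)) ⊎-dec (v ≟ proj₂ (ends e))

  data Walk : V → V → Set where
    []   : ∀ {v} → Walk v v
    step : ∀ {u v w} (e : E) → Joins e u v → Walk v w → Walk u w

  edges : ∀ {u v} → Walk u v → List E
  edges []           = []
  edges (step e _ w) = e ∷ edges w

data Color : Set where
  red blue : Color

_≟ᶜ_ : DecidableEquality Color
red  ≟ᶜ red  = yes refl
red  ≟ᶜ blue = no λ ()
blue ≟ᶜ red  = no λ ()
blue ≟ᶜ blue = yes refl

module _ (G : Graph) where
  open Graph G

  Coloring : Set
  Coloring = E → Color

  redDegree : Coloring → V → ℕ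
  redDegree C v =
    length (filter (λ e → incident? v e ×-dec (C e ≟ᶜ red)) (allFin #E))

  𝒦 : (V → ℕ) → Pred Coloring 0ℓ
  𝒦 d C = ∀ v → redDegree C v ≡ d v

  module _ {c ℓ₁ ℓ₂ ℓ₃} (ℝ : RealNumbers c ℓ₁ ℓ₂ ℓ₃) where
    open RealNumbers ℝ

    incidentSum : Coloring → Color → V → (E → Carrier) → Carrier
    incidentSum C κ v x =
      sum (λ e → if does (incident? v e ×-dec (C e ≟ᶜ κ)) then x e else 0#)

    𝒜 : Coloring → Pred (E → Carrier) (ℓ₁ ⊔ ℓ₃)
    𝒜 C x = (∀ e → 0# ≤ x e) ×
            (∀ v → incidentSum C red v x ≈ incidentSum C blue v x)

  -- The length-zero walk qualifies vacuously; it contains no edge, so it does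
  -- not affect E-of below.
  IsCAW : Coloring → ∀ {v} → Walk v v → Set
  IsCAW C w = Linked DifferentColors (edges w) ×
              Connected DifferentColors (last (edges w)) (head (edges w))
    where
    DifferentColors : Rel E 0ℓ
    DifferentColors e f = C e ≢ C f

  E-of : (V → ℕ) → Pred E 0ℓ
  E-of d e = ∃[ C ] (C ∈ 𝒦 d) ×
    ∃[ v ] Σ (Walk v v) λ w → IsCAW C w × e ∈ˡ edges w

  edgeSetoid : Pred E 0ℓ → Setoid 0ℓ 0ℓ
  edgeSetoid F = On.setoid {B = ∃ F} (setoid E) proj₁

  -- Connectivity and components of the spanning subgraph (V , F).
  module _ (F : Pred E 0ℓ) where

    Adjacent : Rel V 0ℓ
    Adjacent u v = ∃[ e ] (e ∈ F) × Joins e u v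

    Reachable : Rel V 0ℓ
    Reachable = EqClosure.EqClosure Adjacent

    InBipartiteComponent : Pred V 0ℓ
    InBipartiteComponent v = Σ (V → Bool) λ side →
      ∀ {u w} → Reachable v u → Adjacent u w → side u ≢ side w

    -- Vertices of bipartite components, identified when reachable from one
    -- another: the elements up to equality are the bipartite components.
    bipartiteComponents : Setoid 0ℓ 0ℓ
    bipartiteComponents =
      On.setoid {B = ∃ InBipartiteComponent} (EqClosure.setoid Adjacent) proj₁

{-# OPTIONS --safe #-}
module Submission where

-- Write S for the edge set E_d.  Put ⟨x , g⟩ = Σ x(e) g(e) and, for a vertex
-- function y, let g(uv) = ±(y(u) + y(v)) with the sign of the color of uv.
-- Balance at every vertex means ⟨x , g⟩ = 0 for all y.
-- An alternating walk is a directed walk on pairs (vertex, next color), and a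
-- set of such pairs closed under arcs gives a y with all g ≥ 0.  Hence an edge
-- lies on a closed alternating walk of C, or it is "cut": some y has g ≥ 0
-- everywhere and g > 0 on that edge.  A cut edge carries no weight in the cone,
-- and it is a cut edge for every coloring with the same red degrees, so S is the
-- set of edges on closed alternating walks of C alone.  Adding up these walks
-- gives a cone element that is positive on S, so the cone spans the space of all
-- balanced vectors supported on S, which up to signs is the kernel of the
-- unsigned incidence matrix of (V , S).
-- Its dimension is found by inserting the edges of S one by one while recording
-- every unit vector of ℝ^V modulo the columns already present: it is ± one of b
-- basis vectors, b being the number of bipartite components, or zero.  A new
-- column that is zero in this quotient enlarges the kernel by one dimension; any
-- other lowers b by one and leaves the kernel unchanged.

open import Defs
open import Algebra.Apartness.Bundles using (HeytingField)
open import Algebra.Bundles using (AbelianGroup; CommutativeRing)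
import Algebra.Apartness.Properties.HeytingCommutativeRing as HeytingProperties
import Algebra.Definitions.RawMonoid as RawMonoidDefinitions
import Algebra.Properties.AbelianGroup as AbelianGroupProperties
import Algebra.Properties.CommutativeSemigroup as CommutativeSemigroupProperties
import Algebra.Properties.Group as GroupProperties
import Algebra.Properties.Ring as RingProperties
import Algebra.Properties.Semiring.Sum as SemiringSum
import Algebra.Solver.CommutativeMonoid as CommutativeMonoidSolver
open import Data.Bool.Base using (Bool; true; false; if_then_else_; not)
open import Data.Bool.Properties using (not-¬; ¬-not)
open import Data.Empty using (⊥-elim)
open import Data.Fin.Base using (Fin; zero; suc; splitAt; _↑ˡ_; _↑ʳ_; punchIn; punchOut)
open import Data.Fin.Properties
  using (_≟_; any?; splitAt-↑ˡ; splitAt-↑ʳ; punchInᵢ≢i; punchIn-punchOut; punchOut-punchIn; punchOut-cong)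
open import Data.Fin.Subset using (Subset; ⁅_⁆; _∪_; _⊃_) renaming (_∈_ to _∈ˢ_)
open import Data.Fin.Subset.Induction using (⊃-wellFounded; Acc; acc)
open import Data.Fin.Subset.Properties using (_∈?_; x∈⁅x⁆; x∈⁅y⁆⇒x≡y; p⊆p∪q; q⊆p∪q; x∈p∪q⁻)
import Data.Integer.Base as ℤ
import Data.Integer.Properties as ℤₚ
open import Data.List.Base using (List; []; _∷_; head; last; length; filter; allFin; tabulate)
  renaming (lookup to lookupˡ)
open import Data.List.Membership.Propositional using () renaming (_∈_ to _∈ˡ_; _∉_ to _∉ˡ_)
import Data.List.Membership.DecPropositional as DecMembership
open import Data.List.Membership.Propositional.Properties
  using (∈-lookup; ∈-allFin; ∈-filter⁺; ∈-filter⁻)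
import Data.List.Relation.Unary.All as All
open import Data.List.Relation.Unary.AllPairs using (_∷_)
open import Data.List.Relation.Unary.Any using (here; there; index)
open import Data.List.Relation.Unary.Any.Properties using (lookup-index)
open import Data.List.Relation.Unary.Linked using (Linked; []; _∷_; _∷′_)
open import Data.List.Relation.Unary.Unique.Propositional using (Unique)
import Data.List.Relation.Unary.Unique.Propositional.Properties as Uniqueₚ
open import Data.Maybe.Base using (Maybe; just; nothing)
open import Data.Maybe.Properties using (just-injective)
open import Data.Maybe.Relation.Binary.Connected
  using (Connected; just; just-nothing; nothing-just; nothing)
open import Data.Nat.Base as ℕ using (ℕ)
import Data.Nat.Properties as ℕₚ
open import Data.Product.Base using (Σ; ∃-syntax; _×_; _,_; proj₁; proj₂)
open import Data.Product.Properties using (≡-dec)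
open import Data.Sign.Base as Sign using (Sign; opposite)
import Data.Sign.Properties as Signₚ
open import Data.Sum.Base using (_⊎_; inj₁; inj₂; [_,_]′; swap)
open import Data.Vec.Base using (lookup)
open import Data.Vec.Functional using () renaming ([] to []ᵛ; _∷_ to _∷ᵛ_)
open import Data.Vec.Properties using ([]=⇒lookup; lookup⇒[]=)
open import Function.Base using (_∘_; case_of_)
open import Level using (0ℓ; _⊔_)
import Relation.Binary.Construct.Closure.Equivalence as EqClosure
open import Relation.Binary.Construct.Closure.ReflexiveTransitive using (Star; ε; _◅_; _◅◅_)
open import Relation.Binary.Construct.Closure.Symmetric using (fwd; bwd)
open import Relation.Binary.Core using (Rel)
open import Relation.Binary.Definitions using (Decidable)
open import Relation.Binary.PropositionalEquality using (_≡_; _≢_)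
import Relation.Binary.PropositionalEquality as ≡
import Relation.Binary.Reasoning.Setoid as SetoidReasoning
open import Relation.Binary.Structures using (IsStrictPartialOrder)
open import Relation.Nullary using (¬_; Dec; yes; no; does; ¬?)
open import Relation.Nullary.Decidable using (_⊎-dec_; _×-dec_)
open import Relation.Unary using (Pred; _∈_)

-- Order, signs and pairings over an ordered field with apartness.

module OrderedFieldProperties {c ℓ₁ ℓ₂ ℓ₃} (F : OrderedField c ℓ₁ ℓ₂ ℓ₃) where
  open OrderedField F
  open CommutativeRing commutativeRing
    hiding (Carrier; _≈_; _+_; _*_; -_; _-_; 0#; 1#; zero; +-commutativeMonoid; +-rawMonoid)
  open HeytingField heytingField using (tight; #-cotrans; #⇒invertible; invertible⇒#)
  open HeytingProperties heytingCommutativeRing using (1#0; x-0≈x; x#0y#0→xy#0)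
  open AbelianGroupProperties +-abelianGroup using (xyx⁻¹≈y; ⁻¹-∙-comm)
  open RingProperties ring using (-‿distribˡ-*; -‿distribʳ-*; -‿involutive; -0#≈0#)
  open SemiringSum semiring hiding (sum)
  open SetoidReasoning setoid
  module < = IsStrictPartialOrder isStrictPartialOrder

  x<0⇒0<-x : ∀ {x} → x < 0# → 0# < - x
  x<0⇒0<-x {x} x<0 =
    <.<-respʳ-≈ (+-identityˡ (- x)) (<.<-respˡ-≈ (-‿inverseʳ x) (+-monoˡ-< (- x) x<0))

  -x<0⇒0<x : ∀ {x} → - x < 0# → 0# < x
  -x<0⇒0<x {x} -x<0 = <.<-respʳ-≈ (-‿involutive x) (x<0⇒0<-x -x<0)

  0<1 : 0# < 1#
  0<1 with #⇒<⊎> 1#0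
  ... | inj₂ 0<1 = 0<1
  ... | inj₁ 1<0 = <.<-respʳ-≈ -1*-1≈1 (*-pos (x<0⇒0<-x 1<0) (x<0⇒0<-x 1<0))
    where
    -1*-1≈1 : - 1# * - 1# ≈ 1#
    -1*-1≈1 = begin
      - 1# * - 1#    ≈⟨ -‿distribˡ-* 1# (- 1#) ⟨
      - (1# * - 1#)  ≈⟨ -‿cong (*-identityˡ (- 1#)) ⟩
      - - 1#         ≈⟨ -‿involutive 1# ⟩
      1#             ∎

  ≤-reflexive : ∀ {x y} → x ≈ y → x ≤ y
  ≤-reflexive x≈y y<x = <.irrefl (sym x≈y) y<x

  <⇒≤ : ∀ {x y} → x < y → x ≤ y
  <⇒≤ x<y y<x = <.asym x<y y<x

  0≤-resp-≈ : ∀ {x y} → x ≈ y → 0# ≤ x → 0# ≤ y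
  0≤-resp-≈ x≈y 0≤x y<0 = 0≤x (<.<-respˡ-≈ (sym x≈y) y<0)

  x+y<x⇒y<0 : ∀ {x y} → x + y < x → y < 0#
  x+y<x⇒y<0 {x} {y} x+y<x =
    <.<-respˡ-≈ (xyx⁻¹≈y x y) (<.<-respʳ-≈ (-‿inverseʳ x) (+-monoˡ-< (- x) x+y<x))

  0<x⇒y<x+y : ∀ {x y} → 0# < x → y < x + y
  0<x⇒y<x+y {x} {y} 0<x = <.<-respˡ-≈ (+-identityˡ y) (+-monoˡ-< y 0<x)

  -- As `<` is not assumed decidable, the cases come from cotransitivity: `x + y # 0#` gives
  -- `x + y # x` or `x # 0#`, and each apartness yields a strict inequality.
  0≤x+y : ∀ {x y} → 0# ≤ x → 0# ≤ y → 0# ≤ x + y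
  0≤x+y {x} {y} 0≤x 0≤y x+y<0 with #-cotrans (<⇒# x+y<0) x
  ... | inj₁ x+y#x with #⇒<⊎> x+y#x
  ...   | inj₁ x+y<x = 0≤y (x+y<x⇒y<0 x+y<x)
  ...   | inj₂ x<x+y = 0≤x (<.trans x<x+y x+y<0)
  0≤x+y {x} {y} 0≤x 0≤y x+y<0 | inj₂ x#0 with #⇒<⊎> x#0
  ...   | inj₁ x<0 = 0≤x x<0
  ...   | inj₂ 0<x = 0≤y (<.trans (0<x⇒y<x+y 0<x) x+y<0)

  0<x+y : ∀ {x y} → 0# < x → 0# ≤ y → 0# < x + y
  0<x+y {x} {y} 0<x 0≤y with #-cotrans (<⇒# 0<x) (x + y)
  ... | inj₁ 0#x+y with #⇒<⊎> 0#x+y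
  ...   | inj₁ 0<x+y = 0<x+y
  ...   | inj₂ x+y<0 = ⊥-elim (0≤x+y (<⇒≤ 0<x) 0≤y x+y<0)
  0<x+y {x} {y} 0<x 0≤y | inj₂ x+y#x with #⇒<⊎> x+y#x
  ...   | inj₁ x+y<x = ⊥-elim (0≤y (x+y<x⇒y<0 x+y<x))
  ...   | inj₂ x<x+y = <.trans 0<x x<x+y

  #0⇒0< : ∀ {x} → 0# ≤ x → x # 0# → 0# < x
  #0⇒0< 0≤x x#0 with #⇒<⊎> x#0
  ... | inj₁ x<0 = ⊥-elim (0≤x x<0)
  ... | inj₂ 0<x = 0<x

  -- Apartness from zero is invertibility, and `y` times an inverse of `x * y` inverts `x`.
  x*y#0⇒x#0 : ∀ {x y} → x * y # 0# → x # 0#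
  x*y#0⇒x#0 {x} {y} xy#0 with #⇒invertible xy#0
  ... | z , z*xy≈1 , _ = invertible⇒# (y * z , left , trans (*-comm _ _) left)
    where
    left : (y * z) * (x - 0#) ≈ 1#
    left = begin
      (y * z) * (x - 0#)    ≈⟨ *-congˡ (x-0≈x x) ⟩
      (y * z) * x           ≈⟨ *-congʳ (*-comm y z) ⟩
      (z * y) * x           ≈⟨ *-assoc z y x ⟩
      z * (y * x)           ≈⟨ *-congˡ (*-comm y x) ⟩
      z * (x * y)           ≈⟨ *-congˡ (x-0≈x (x * y)) ⟨
      z * ((x * y) - 0#)    ≈⟨ z*xy≈1 ⟩
      1#                    ∎

  -- A negative product is apart from zero, hence so are both factors; being nonnegative, they are
  -- then positive, and so is their product.
  0≤x*y : ∀ {x y} → 0# ≤ x → 0# ≤ y → 0# ≤ x * y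
  0≤x*y {x} {y} 0≤x 0≤y xy<0 = <.asym xy<0 (*-pos (#0⇒0< 0≤x x#0) (#0⇒0< 0≤y y#0))
    where
    x#0 = x*y#0⇒x#0 (<⇒# xy<0)
    y#0 = x*y#0⇒x#0 (<⇒# (<.<-respˡ-≈ (*-comm x y) xy<0))

  0≤sum : ∀ {n} (f : Fin n → Carrier) → (∀ i → 0# ≤ f i) → 0# ≤ sum f
  0≤sum {ℕ.zero}  f 0≤f = ≤-reflexive refl
  0≤sum {ℕ.suc n} f 0≤f = 0≤x+y (0≤f zero) (0≤sum (f ∘ suc) (0≤f ∘ suc))

  0<sum : ∀ {n} (f : Fin n → Carrier) → (∀ i → 0# ≤ f i) → ∀ j → 0# < f j → 0# < sum f
  0<sum f 0≤f zero    0<fj = 0<x+y 0<fj (0≤sum (f ∘ suc) (0≤f ∘ suc))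
  0<sum f 0≤f (suc j) 0<fj =
    <.<-respʳ-≈ (+-comm _ _) (0<x+y (0<sum (f ∘ suc) (0≤f ∘ suc) j 0<fj) (0≤f zero))

  x*y≈0∧y#0⇒x≈0 : ∀ {x y} → x * y ≈ 0# → y # 0# → x ≈ 0#
  x*y≈0∧y#0⇒x≈0 {x} {y} xy≈0 y#0 =
    proj₁ (tight x 0#) λ x#0 → proj₂ (tight (x * y) 0#) xy≈0 (x#0y#0→xy#0 x#0 y#0)

  sum-zero : ∀ {n} (f : Fin n → Carrier) → (∀ i → f i ≈ 0#) → sum f ≈ 0#
  sum-zero {n} f f≈0 = trans (sum-cong-≋ f≈0) (sum-replicate-zero n)

  sum-single : ∀ {n} (f : Fin n → Carrier) j → (∀ i → i ≢ j → f i ≈ 0#) → sum f ≈ f j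
  sum-single f zero f≈0 = begin
    f zero + sum (f ∘ suc)  ≈⟨ +-congˡ (sum-zero (f ∘ suc) λ i → f≈0 (suc i) λ ()) ⟩
    f zero + 0#             ≈⟨ +-identityʳ (f zero) ⟩
    f zero                  ∎
  sum-single f (suc j) f≈0 = begin
    f zero + sum (f ∘ suc)  ≈⟨ +-cong (f≈0 zero λ ()) (sum-single (f ∘ suc) j λ i i≢j →
                                 f≈0 (suc i) λ { ≡.refl → i≢j ≡.refl }) ⟩
    0# + f (suc j)          ≈⟨ +-identityˡ (f (suc j)) ⟩
    f (suc j)               ∎

  sum-‿- : ∀ {n} (f : Fin n → Carrier) → sum (λ i → - f i) ≈ - sum f
  sum-‿- {ℕ.zero}  f = sym -0#≈0#
  sum-‿- {ℕ.suc n} f = trans (+-congˡ (sum-‿- (f ∘ suc))) (⁻¹-∙-comm _ _)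

  infixr 8 _◃_
  _◃_ : Sign → Carrier → Carrier
  Sign.+ ◃ x = x
  Sign.- ◃ x = - x

  ◃-cong : ∀ s {x y} → x ≈ y → s ◃ x ≈ s ◃ y
  ◃-cong Sign.+ x≈y = x≈y
  ◃-cong Sign.- x≈y = -‿cong x≈y

  ◃-distrib-+ : ∀ s x y → s ◃ (x + y) ≈ s ◃ x + s ◃ y
  ◃-distrib-+ Sign.+ x y = refl
  ◃-distrib-+ Sign.- x y = sym (⁻¹-∙-comm x y)

  ◃-selfInverse : ∀ s x → s ◃ s ◃ x ≈ x
  ◃-selfInverse Sign.+ x = refl
  ◃-selfInverse Sign.- x = -‿involutive x

  opposite-◃ : ∀ s x → opposite s ◃ x ≈ - (s ◃ x)
  opposite-◃ Sign.+ x = refl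
  opposite-◃ Sign.- x = sym (-‿involutive x)

  ◃-0# : ∀ s → s ◃ 0# ≈ 0#
  ◃-0# Sign.+ = refl
  ◃-0# Sign.- = -0#≈0#

  ◃-*ˡ : ∀ s x y → (s ◃ x) * y ≈ s ◃ (x * y)
  ◃-*ˡ Sign.+ x y = refl
  ◃-*ˡ Sign.- x y = sym (-‿distribˡ-* x y)

  ◃-*ʳ : ∀ s x y → x * (s ◃ y) ≈ s ◃ (x * y)
  ◃-*ʳ Sign.+ x y = refl
  ◃-*ʳ Sign.- x y = sym (-‿distribʳ-* x y)

  ◃-#0 : ∀ s {x} → x # 0# → s ◃ x # 0#
  ◃-#0 Sign.+ x#0 = x#0
  ◃-#0 Sign.- {x} x#0 with #⇒<⊎> x#0
  ... | inj₁ x<0 = HeytingField.#-sym heytingField (<⇒# (x<0⇒0<-x x<0))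
  ... | inj₂ 0<x = <⇒# (<.<-respʳ-≈ (-‿inverseʳ x) (<.<-respˡ-≈ (+-identityˡ (- x)) (+-monoˡ-< (- x) 0<x)))

  2# : Carrier
  2# = 1# + 1#

  2#0 : 2# # 0#
  2#0 = HeytingField.#-sym heytingField (<⇒# (0<x+y 0<1 (<⇒≤ 0<1)))

  ½ : Carrier
  ½ = proj₁ (#⇒invertible 2#0)

  ½*2≈1 : ½ * 2# ≈ 1#
  ½*2≈1 = trans (*-congˡ (sym (x-0≈x 2#))) (proj₁ (proj₂ (#⇒invertible 2#0)))

  ½[x+x]≈x : ∀ x → ½ * (x + x) ≈ x
  ½[x+x]≈x x = begin
    ½ * (x + x)            ≈⟨ *-congˡ (+-cong (*-identityˡ x) (*-identityˡ x)) ⟨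
    ½ * (1# * x + 1# * x)  ≈⟨ *-congˡ (distribʳ x 1# 1#) ⟨
    ½ * (2# * x)           ≈⟨ *-assoc ½ 2# x ⟨
    (½ * 2#) * x           ≈⟨ *-congʳ ½*2≈1 ⟩
    1# * x                 ≈⟨ *-identityˡ x ⟩
    x                      ∎

  ⟨_,_⟩ : ∀ {n} → (Fin n → Carrier) → (Fin n → Carrier) → Carrier
  ⟨ x , g ⟩ = sum (λ e → x e * g e)

  module _ {n : ℕ} where

    private
      Vect : Set c
      Vect = Fin n → Carrier

    ⟨⟩-congˡ : ∀ {x y : Vect} g → (∀ e → x e ≈ y e) → ⟨ x , g ⟩ ≈ ⟨ y , g ⟩
    ⟨⟩-congˡ g x≈y = sum-cong-≋ λ e → *-congʳ (x≈y e)

    ⟨⟩-congʳ : ∀ (x : Vect) {g h} → (∀ e → g e ≈ h e) → ⟨ x , g ⟩ ≈ ⟨ x , h ⟩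
    ⟨⟩-congʳ x g≈h = sum-cong-≋ λ e → *-congˡ (g≈h e)

    ⟨⟩-distribʳ-+ : ∀ (x y g : Vect) → ⟨ (λ e → x e + y e) , g ⟩ ≈ ⟨ x , g ⟩ + ⟨ y , g ⟩
    ⟨⟩-distribʳ-+ x y g = begin
      ⟨ (λ e → x e + y e) , g ⟩              ≈⟨ sum-cong-≋ (λ e → distribʳ (g e) (x e) (y e)) ⟩
      sum (λ e → x e * g e + y e * g e)      ≈⟨ ∑-distrib-+ (λ e → x e * g e) (λ e → y e * g e) ⟩
      ⟨ x , g ⟩ + ⟨ y , g ⟩                  ∎

    ⟨⟩-*ˡ : ∀ a (x g : Vect) → ⟨ (λ e → a * x e) , g ⟩ ≈ a * ⟨ x , g ⟩
    ⟨⟩-*ˡ a x g = begin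
      ⟨ (λ e → a * x e) , g ⟩        ≈⟨ sum-cong-≋ (λ e → *-assoc a (x e) (g e)) ⟩
      sum (λ e → a * (x e * g e))    ≈⟨ *-distribˡ-sum a (λ e → x e * g e) ⟨
      a * ⟨ x , g ⟩                  ∎

    ⟨⟩-‿- : ∀ (x g : Vect) → ⟨ (λ e → - x e) , g ⟩ ≈ - ⟨ x , g ⟩
    ⟨⟩-‿- x g = trans (sum-cong-≋ λ e → sym (-‿distribˡ-* (x e) (g e))) (sum-‿- λ e → x e * g e)

    ⟨⟩-zeroˡ : ∀ (g : Vect) → ⟨ (λ _ → 0#) , g ⟩ ≈ 0#
    ⟨⟩-zeroˡ g = sum-zero (λ e → 0# * g e) λ e → zeroˡ (g e)

    ⟨⟩-lincomb : ∀ {k} (a : Fin k → Carrier) (v : Fin k → Vect) g →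
      ⟨ (λ e → sum (λ i → a i * v i e)) , g ⟩ ≈ sum (λ i → a i * ⟨ v i , g ⟩)
    ⟨⟩-lincomb a v g = begin
      sum (λ e → sum (λ i → a i * v i e) * g e)    ≈⟨ sum-cong-≋ (λ e → *-distribʳ-sum (g e) (λ i → a i * v i e)) ⟩
      sum (λ e → sum (λ i → a i * v i e * g e))    ≈⟨ ∑-comm (λ e i → a i * v i e * g e) ⟩
      sum (λ i → sum (λ e → a i * v i e * g e))    ≈⟨ sum-cong-≋ (λ i → ⟨⟩-*ˡ (a i) (v i) g) ⟩
      sum (λ i → a i * ⟨ v i , g ⟩)                ∎

    unit : Fin n → Vect
    unit i j = if does (i ≟ j) then 1# else 0#

    unit-≡ : ∀ i → unit i i ≈ 1#
    unit-≡ i with i ≟ i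
    ... | yes _   = refl
    ... | no  i≢i = ⊥-elim (i≢i ≡.refl)

    unit-≢ : ∀ {i j} → i ≢ j → unit i j ≈ 0#
    unit-≢ {i} {j} i≢j with i ≟ j
    ... | yes i≡j = ⊥-elim (i≢j i≡j)
    ... | no  _   = refl

    ⟨unit⟩ : ∀ i (g : Vect) → ⟨ unit i , g ⟩ ≈ g i
    ⟨unit⟩ i g = begin
      ⟨ unit i , g ⟩   ≈⟨ sum-single _ i (λ j j≢i → trans (*-congʳ (unit-≢ (j≢i ∘ ≡.sym))) (zeroˡ (g j))) ⟩
      unit i i * g i   ≈⟨ *-congʳ (unit-≡ i) ⟩
      1# * g i         ≈⟨ *-identityˡ (g i) ⟩
      g i              ∎

    ⟨⟩-◃ : ∀ s (x g : Vect) → ⟨ (λ e → s ◃ x e) , g ⟩ ≈ s ◃ ⟨ x , g ⟩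
    ⟨⟩-◃ Sign.+ x g = refl
    ⟨⟩-◃ Sign.- x g = ⟨⟩-‿- x g

    unit≥0 : ∀ i j → 0# ≤ unit i j
    unit≥0 i j with does (i ≟ j)
    ... | true  = <⇒≤ 0<1
    ... | false = ≤-reflexive refl

-- Reachability in a finite directed graph.

reachableSet : ∀ {A : Set} {n} {R : Rel A 0ℓ} (encode : A → Fin n) (decode : Fin n → A) →
  (∀ a → decode (encode a) ≡ a) → Decidable R → ∀ s →
  ∃[ S ] S s ≡ true × (∀ {a} → S a ≡ true → Star R s a) ×
         (∀ {a b} → S a ≡ true → R a b → S b ≡ true)
reachableSet {A} {n} {R} encode decode decode∘encode R? s =
  -- Targets of arcs leaving the set are added one at a time; the strict superset order on subsets
  -- of `Fin n` is well-founded, so this ends with a set closed under arcs.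
  grow ⁅ encode s ⁆ (⊃-wellFounded _) (x∈⁅x⁆ (encode s)) λ i∈⁅s⁆ →
    ≡.subst (Star R s) (≡.trans (≡.sym (decode∘encode s)) (≡.cong decode (≡.sym (x∈⁅y⁆⇒x≡y _ i∈⁅s⁆)))) ε
  where
  grow : (S : Subset n) → Acc _⊃_ S → encode s ∈ˢ S → (∀ {i} → i ∈ˢ S → Star R s (decode i)) →
    ∃[ S ] S s ≡ true × (∀ {a} → S a ≡ true → Star R s a) ×
           (∀ {a b} → S a ≡ true → R a b → S b ≡ true)
  grow S (acc rec) s∈S reached
    with any? (λ i → any? (λ j → (i ∈? S ×-dec R? (decode i) (decode j)) ×-dec ¬? (j ∈? S)))
  ... | yes (i , j , (i∈S , iRj) , j∉S) =
    grow (S ∪ ⁅ j ⁆) (rec (p⊆p∪q ⁅ j ⁆ , j , q⊆p∪q S ⁅ j ⁆ (x∈⁅x⁆ j) , j∉S)) (p⊆p∪q ⁅ j ⁆ s∈S) reached′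
    where
    reached′ : ∀ {k} → k ∈ˢ S ∪ ⁅ j ⁆ → Star R s (decode k)
    reached′ k∈ with x∈p∪q⁻ S ⁅ j ⁆ k∈
    ... | inj₁ k∈S   = reached k∈S
    ... | inj₂ k∈⁅j⁆ =
      ≡.subst (Star R s) (≡.cong decode (≡.sym (x∈⁅y⁆⇒x≡y j k∈⁅j⁆))) (reached i∈S ◅◅ iRj ◅ ε)
  ... | no closed = lookup S ∘ encode , []=⇒lookup s∈S , sound , stable
    where
    member : ∀ {a} → lookup S (encode a) ≡ true → encode a ∈ˢ S
    member = lookup⇒[]= _ S

    sound : ∀ {a} → lookup S (encode a) ≡ true → Star R s a
    sound {a} a∈S = ≡.subst (Star R s) (decode∘encode a) (reached (member a∈S))

    stable : ∀ {a b} → lookup S (encode a) ≡ true → R a b → lookup S (encode b) ≡ true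
    stable {a} {b} a∈S aRb with encode b ∈? S
    ... | yes b∈S = []=⇒lookup b∈S
    ... | no  b∉S = ⊥-elim (closed (encode a , encode b ,
      (member a∈S , ≡.subst₂ R (≡.sym (decode∘encode a)) (≡.sym (decode∘encode b)) aRb) , b∉S))

-- Alternating walks as directed walks.

oppositeᶜ : Color → Color
oppositeᶜ red  = blue
oppositeᶜ blue = red

oppositeᶜ-involutive : ∀ κ → oppositeᶜ (oppositeᶜ κ) ≡ κ
oppositeᶜ-involutive red  = ≡.refl
oppositeᶜ-involutive blue = ≡.refl

κ≢oppositeᶜ : ∀ κ → κ ≢ oppositeᶜ κ
κ≢oppositeᶜ red  ()
κ≢oppositeᶜ blue ()

sign : Color → Sign
sign red  = Sign.+
sign blue = Sign.-

module AlternatingWalks (G : Graph) (C : Coloring G) where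
  open Graph G

  OnCAW : E → Set
  OnCAW e = ∃[ v ] Σ (Walk v v) λ w → IsCAW G C w × e ∈ˡ edges w

  -- A node is a vertex together with the color of the edge by which an
  -- alternating walk leaves it, so that alternating walks are directed walks.
  Node : Set
  Node = V × Color

  Arc : Rel Node 0ℓ
  Arc (u , κ) (v , κ′) = ∃[ e ] Joins e u v × C e ≡ κ × κ′ ≡ oppositeᶜ κ

  arc? : Decidable Arc
  arc? (u , κ) (v , κ′) = any? λ e →
    (≡-dec _≟_ _≟_ (ends e) (u , v) ⊎-dec ≡-dec _≟_ _≟_ (ends e) (v , u)) ×-dec
    (C e ≟ᶜ κ) ×-dec (κ′ ≟ᶜ oppositeᶜ κ)

  encode : Node → Fin (#V ℕ.+ #V)
  encode (v , red)  = v ↑ˡ #V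
  encode (v , blue) = #V ↑ʳ v

  decode : Fin (#V ℕ.+ #V) → Node
  decode i = [ _, red , _, blue ]′ (splitAt #V i)

  decode∘encode : ∀ p → decode (encode p) ≡ p
  decode∘encode (v , red)  = ≡.cong [ _, red , _, blue ]′ (splitAt-↑ˡ #V v #V)
  decode∘encode (v , blue) = ≡.cong [ _, red , _, blue ]′ (splitAt-↑ʳ #V #V v)

  toWalk : ∀ {p q} → Star Arc p q → Walk (proj₁ p) (proj₁ q)
  toWalk ε                = []
  toWalk ((e , j , _) ◅ p) = step e j (toWalk p)

  -- Both arguments are `Maybe` edges so that one lemma serves the links inside a walk and the
  -- closing link from its last edge to its first.
  connected : ∀ {κ} (m m′ : Maybe E) → (∀ {e} → m ≡ just e → C e ≡ κ) →
    (∀ {e} → m′ ≡ just e → C e ≡ oppositeᶜ κ) → Connected (λ e f → C e ≢ C f) m m′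
  connected (just e) (just f) h h′ =
    just λ Ce≡Cf → κ≢oppositeᶜ _ (≡.trans (≡.sym (h ≡.refl)) (≡.trans Ce≡Cf (h′ ≡.refl)))
  connected (just e) nothing  h h′ = just-nothing
  connected nothing  (just f) h h′ = nothing-just
  connected nothing  nothing  h h′ = nothing

  head-toWalk : ∀ {p q} (π : Star Arc p q) {f} → head (edges (toWalk π)) ≡ just f → C f ≡ proj₂ p
  head-toWalk ε ()
  head-toWalk ((e , _ , Ce≡κ , _) ◅ π) ≡.refl = Ce≡κ

  last-toWalk : ∀ {p q} (π : Star Arc p q) {f} →
    last (edges (toWalk π)) ≡ just f → C f ≡ oppositeᶜ (proj₂ q)
  last-toWalk ε ()
  last-toWalk ((e , _ , ≡.refl , ≡.refl) ◅ ε) ≡.refl = ≡.sym (oppositeᶜ-involutive (C e))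
  last-toWalk (_ ◅ π@(_ ◅ _)) last≡f = last-toWalk π last≡f

  linked-toWalk : ∀ {p q} (π : Star Arc p q) → Linked (λ e f → C e ≢ C f) (edges (toWalk π))
  linked-toWalk ε = []
  linked-toWalk ((e , _ , ≡.refl , ≡.refl) ◅ π) =
    connected (just e) _ (λ { ≡.refl → ≡.refl }) (head-toWalk π) ∷′ linked-toWalk π

  -- Every arc flips the color component, so a walk that returns to the node with color `κ` starts
  -- with an edge of color `κ` and ends with one of the opposite color.
  closed⇒CAW : ∀ {p} (π : Star Arc p p) → IsCAW G C (toWalk π)
  closed⇒CAW {_ , κ} π = linked-toWalk π ,
    connected {oppositeᶜ κ} _ _ (last-toWalk π) (λ h → ≡.trans (head-toWalk π h) (≡.sym (oppositeᶜ-involutive κ)))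

  -- Crossing `e` from its first end leads to the node (second end, opposite color), and `S` is what
  -- can be reached from there. If the node from which `e` was crossed is in `S`, the walk closes
  -- up; otherwise `S` separates the two nodes.
  onCAW-or-cut : ∀ e → OnCAW e ⊎ (∃[ S ]
    (∀ {p q} → S p ≡ true → Arc p q → S q ≡ true) ×
    S (proj₂ (ends e) , oppositeᶜ (C e)) ≡ true ×
    S (proj₁ (ends e) , C e) ≡ false)
  onCAW-or-cut e with reachableSet encode decode decode∘encode arc? (proj₂ (ends e) , oppositeᶜ (C e))
  ... | S , s∈S , sound , stable with S (proj₁ (ends e) , C e) in eq
  ...   | true  = inj₁ (_ , toWalk cycle , closed⇒CAW cycle , here ≡.refl)
    where cycle = (e , inj₁ ≡.refl , ≡.refl , ≡.refl) ◅ sound eq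
  ...   | false = inj₂ (S , stable , s∈S , eq)

-- Component labels under insertion of edges.

module ComponentLabels (G : Graph) where
  open Graph G

  -- The sign is the parity of the length, `+` for even.
  data SignedWalk (L : List E) : V → V → Sign → Set where
    []  : ∀ {v} → SignedWalk L v v Sign.+
    _∷_ : ∀ {u v w s} → (∃[ e ] e ∈ˡ L × Joins e u v) → SignedWalk L v w s → SignedWalk L u w (opposite s)

  module _ {L : List E} where

    infixr 5 _++_
    _++_ : ∀ {u v w s t} → SignedWalk L u v s → SignedWalk L v w t → SignedWalk L u w (s Sign.* t)
    [] ++ q = q
    _∷_ {s = s} e p ++ q = ≡.subst (SignedWalk L _ _) (≡.sym (Signₚ.*-assoc Sign.- s _)) (e ∷ (p ++ q))

    reverse : ∀ {u v s} → SignedWalk L u v s → SignedWalk L v u s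
    reverse [] = []
    reverse (_∷_ {s = s} (e , e∈L , j) p) = ≡.subst (SignedWalk L _ _) (Signₚ.*-comm s Sign.-)
      (reverse p ++ ((e , e∈L , swap j) ∷ []))

    weaken : ∀ {e u v s} → SignedWalk L u v s → SignedWalk (e ∷ L) u v s
    weaken []                  = []
    weaken ((e , e∈L , j) ∷ p) = (e , there e∈L , j) ∷ weaken p

    -- Going along `p`, around the odd closed walk and back along `p` adds an even number of steps
    -- to an odd one.
    conjugate : ∀ {u v s} → SignedWalk L u v s → SignedWalk L v v Sign.- → SignedWalk L u u Sign.-
    conjugate {s = s} p q = ≡.subst (SignedWalk L _ _) (s*-*s s) (p ++ q ++ reverse p)
      where
      s*-*s : ∀ s → s Sign.* (Sign.- Sign.* s) ≡ Sign.-
      s*-*s Sign.+ = ≡.refl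
      s*-*s Sign.- = ≡.refl

  -- The class of the unit vector of a vertex modulo the columns of the
  -- incidence matrix: plus or minus the class of a bipartite component, or zero.
  Label : ℕ → Set
  Label b = Maybe (Fin b × Sign)

  scale : ∀ {b} → Sign → Label b → Label b
  scale s nothing        = nothing
  scale s (just (c , t)) = just (c , s Sign.* t)

  scale-* : ∀ {b} s t (l : Label b) → scale (s Sign.* t) l ≡ scale s (scale t l)
  scale-* s t nothing        = ≡.refl
  scale-* s t (just (c , r)) = ≡.cong (λ r → just (c , r)) (Signₚ.*-assoc s t r)

  scale-+ : ∀ {b} (l : Label b) → scale Sign.+ l ≡ l
  scale-+ nothing  = ≡.refl
  scale-+ (just _) = ≡.refl

  scale-selfInverse : ∀ {b} {l m : Label b} → l ≡ scale Sign.- m → m ≡ scale Sign.- l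
  scale-selfInverse {m = m} ≡.refl = ≡.trans (≡.sym (scale-+ m)) (scale-* Sign.- Sign.- m)

  joins-opposite : ∀ {b} (label : V → Label b) {e u v} → Joins e u v → label u ≡ scale Sign.- (label v) →
    label (proj₁ (ends e)) ≡ scale Sign.- (label (proj₂ (ends e)))
  joins-opposite label (inj₁ eq) rewrite eq = λ opp → opp
  joins-opposite label (inj₂ eq) rewrite eq = scale-selfInverse

  opposite-joins : ∀ {b} (label : V → Label b) {e u v} → Joins e u v →
    label (proj₁ (ends e)) ≡ scale Sign.- (label (proj₂ (ends e))) → label u ≡ scale Sign.- (label v)
  opposite-joins label (inj₁ eq) rewrite eq = λ opp → opp
  opposite-joins label (inj₂ eq) rewrite eq = scale-selfInverse

  -- The evidence for a label. A walk of sign `s` to the root makes the unit vector of `v` equal to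
  -- `s` times that of the root modulo the columns; an odd closed walk makes twice the unit vector
  -- of `v` vanish there.
  Anchor : ∀ {b} → List E → (Fin b → V) → V → Label b → Set
  Anchor L root v nothing        = SignedWalk L v v Sign.-
  Anchor L root v (just (c , s)) = SignedWalk L v (root c) s

  anchor-walk : ∀ {b L} {root : Fin b → V} {u v s} l →
    SignedWalk L u v s → Anchor L root v l → Anchor L root u (scale s l)
  anchor-walk nothing  p q = conjugate p q
  anchor-walk (just _) p q = p ++ q

  -- Read as a linear map to a space with `b` coordinates, `label` kills the columns of `L` by
  -- `opposite-ends`, is onto by `label-root`, and kills nothing beyond their span by `anchor`.
  record Labelling (L : List E) (b : ℕ) : Set where
    field
      label      : V → Label b
      root       : Fin b → V
      label-root : ∀ c → label (root c) ≡ just (c , Sign.+)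
      anchor     : ∀ v → Anchor L root v (label v)
      opposite-ends : ∀ {e} → e ∈ˡ L → label (proj₁ (ends e)) ≡ scale Sign.- (label (proj₂ (ends e)))

  initial : Labelling [] #V
  initial = record
    { label         = λ v → just (v , Sign.+)
    ; root          = λ v → v
    ; label-root    = λ _ → ≡.refl
    ; anchor        = λ _ → []
    ; opposite-ends = λ ()
    }

  replace : ∀ {b} → Fin (ℕ.suc b) → Label b → Fin (ℕ.suc b) → Label b
  replace c τ d with c ≟ d
  ... | yes _   = τ
  ... | no  c≢d = just (punchOut c≢d , Sign.+)

  replace-≡ : ∀ {b} (c : Fin (ℕ.suc b)) τ → replace c τ c ≡ τ
  replace-≡ c τ with c ≟ c
  ... | yes _   = ≡.refl
  ... | no  c≢c = ⊥-elim (c≢c ≡.refl)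

  replace-≢ : ∀ {b} {c d : Fin (ℕ.suc b)} τ (c≢d : c ≢ d) → replace c τ d ≡ just (punchOut c≢d , Sign.+)
  replace-≢ {c = c} {d} τ c≢d with c ≟ d
  ... | yes c≡d = ⊥-elim (c≢d c≡d)
  ... | no  _   = ≡.cong (λ i → just (i , Sign.+)) (punchOut-cong c ≡.refl)

  -- Passage to the quotient by the relation that class `c` equals `τ`.
  substitute : ∀ {b} → Fin (ℕ.suc b) → Label b → Label (ℕ.suc b) → Label b
  substitute c τ nothing        = nothing
  substitute c τ (just (d , s)) = scale s (replace c τ d)

  substitute-scale : ∀ {b} (c : Fin (ℕ.suc b)) τ s l → substitute c τ (scale s l) ≡ scale s (substitute c τ l)
  substitute-scale c τ s nothing        = ≡.refl
  substitute-scale c τ s (just (d , t)) = scale-* s t (replace c τ d)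

  extend : ∀ {L b} (Λ : Labelling L b) {e} → let open Labelling Λ in
    label (proj₁ (ends e)) ≡ scale Sign.- (label (proj₂ (ends e))) → Labelling (e ∷ L) b
  extend Λ {e} opp = record
    { label         = label
    ; root          = root
    ; label-root    = label-root
    ; anchor        = λ v → weaken-anchor (label v) (anchor v)
    ; opposite-ends = λ { (here ≡.refl) → opp ; (there f∈L) → opposite-ends f∈L }
    }
    where
    open Labelling Λ
    weaken-anchor : ∀ l {v} → Anchor _ root v l → Anchor (e ∷ _) root v l
    weaken-anchor nothing  = weaken
    weaken-anchor (just _) = weaken

  -- One relation removes one class. Only the root of `c` and the new edge need fresh evidence:
  -- substitution commutes with signs, so the old edges keep opposite ends, and the old anchors are
  -- continued through the root of `c` where necessary.
  eliminate : ∀ {L b} (Λ : Labelling L (ℕ.suc b)) (c : Fin (ℕ.suc b)) τ {e} → let open Labelling Λ in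
    Anchor (e ∷ L) (root ∘ punchIn c) (root c) τ →
    substitute c τ (label (proj₁ (ends e))) ≡ scale Sign.- (substitute c τ (label (proj₂ (ends e)))) →
    Labelling (e ∷ L) b
  eliminate {L} {b} Λ c τ {e} τ-anchor opp = record
    { label         = substitute c τ ∘ label
    ; root          = root ∘ punchIn c
    ; label-root    = label-root′
    ; anchor        = λ v → anchor′ (label v) (anchor v)
    ; opposite-ends = opposite-ends′
    }
    where
    open Labelling Λ

    label-root′ : ∀ d → substitute c τ (label (root (punchIn c d))) ≡ just (d , Sign.+)
    label-root′ d rewrite label-root (punchIn c d) =
      ≡.trans (scale-+ _) (≡.trans (replace-≢ τ (punchInᵢ≢i c d ∘ ≡.sym))
        (≡.cong (λ i → just (i , Sign.+)) (≡.trans (punchOut-cong c ≡.refl) (punchOut-punchIn c))))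

    replaced : ∀ d → Anchor (e ∷ L) (root ∘ punchIn c) (root d) (replace c τ d)
    replaced d with c ≟ d
    ... | yes ≡.refl = τ-anchor
    ... | no  c≢d    = ≡.subst (λ i → SignedWalk _ (root d) (root i) Sign.+) (≡.sym (punchIn-punchOut c≢d)) []

    opposite-ends′ : ∀ {f} → f ∈ˡ e ∷ L → substitute c τ (label (proj₁ (ends f))) ≡
      scale Sign.- (substitute c τ (label (proj₂ (ends f))))
    opposite-ends′ (here ≡.refl)   = opp
    opposite-ends′ {f} (there f∈L) = ≡.trans (≡.cong (substitute c τ) (opposite-ends f∈L))
      (substitute-scale c τ Sign.- (label (proj₂ (ends f))))

    anchor′ : ∀ l {v} → Anchor L root v l → Anchor (e ∷ L) (root ∘ punchIn c) v (substitute c τ l)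
    anchor′ nothing        p = weaken p
    anchor′ (just (d , s)) p = anchor-walk (replace c τ d) (weaken p) (replaced d)

  -- An odd closed walk at `u`, moved to the root of `c`, turns class `c` into zero. This serves an
  -- edge to a vertex labelled zero and an edge between two vertices of the same class and sign.
  eliminate-odd : ∀ {L b} (Λ : Labelling L (ℕ.suc b)) → let open Labelling Λ in
    ∀ {c s e u v} → Joins e u v → label u ≡ just (c , s) →
    SignedWalk (e ∷ L) u u Sign.- → substitute c nothing (label v) ≡ nothing → Labelling (e ∷ L) b
  eliminate-odd Λ {c} {s} {e} {u} {v} j lu odd lv = eliminate Λ c nothing
    (conjugate (reverse (weaken u⇝root)) odd)
    (joins-opposite (substitute c nothing ∘ label) j (≡.trans eq (≡.sym (≡.cong (scale Sign.-) lv))))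
    where
    open Labelling Λ
    u⇝root : SignedWalk _ u (root c) s
    u⇝root = ≡.subst (Anchor _ root u) lu (anchor u)

    eq : substitute c nothing (label u) ≡ nothing
    eq rewrite lu | replace-≡ c nothing = ≡.refl

  merge : ∀ {L b} (Λ : Labelling L (ℕ.suc b)) → let open Labelling Λ in
    ∀ {c d s t e u v} → Joins e u v → c ≢ d → label u ≡ just (c , s) → label v ≡ just (d , t) →
    Labelling (e ∷ L) b
  merge {L} Λ {c} {d} {s} {t} {e} {u} {v} j c≢d lu lv = eliminate Λ c τ τ-anchor
    (joins-opposite (substitute c τ ∘ label) j eq)
    where
    open Labelling Λ
    -- The sign is that of the walk from the root of `c` to `u`, across `e` to `v`, and on to the
    -- root of `d`.
    τ = just (punchOut c≢d , s Sign.* opposite t)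

    τ-anchor : SignedWalk (e ∷ L) (root c) (root (punchIn c (punchOut c≢d))) (s Sign.* opposite t)
    τ-anchor = ≡.subst (λ i → SignedWalk _ (root c) (root i) _) (≡.sym (punchIn-punchOut c≢d))
      (reverse (weaken (≡.subst (Anchor L root u) lu (anchor u))) ++
       ((e , here ≡.refl , j) ∷ weaken (≡.subst (Anchor L root v) lv (anchor v))))

    signs : ∀ s t → s Sign.* (s Sign.* opposite t) ≡ Sign.- Sign.* (t Sign.* Sign.+)
    signs Sign.+ Sign.+ = ≡.refl
    signs Sign.+ Sign.- = ≡.refl
    signs Sign.- Sign.+ = ≡.refl
    signs Sign.- Sign.- = ≡.refl

    eq : substitute c τ (label u) ≡ scale Sign.- (substitute c τ (label v))
    eq rewrite lu | lv | replace-≡ c τ | replace-≢ τ c≢d =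
      ≡.cong (λ r → just (punchOut c≢d , r)) (signs s t)

  -- The new column of the incidence matrix is dependent on, or independent of,
  -- the old ones.
  data Attachment (L : List E) (e : E) : ∀ b → Labelling L b → Set where
    dependent   : ∀ {b} {Λ : Labelling L b} → let open Labelling Λ in
      label (proj₁ (ends e)) ≡ scale Sign.- (label (proj₂ (ends e))) → Attachment L e b Λ
    independent : ∀ {b} {Λ : Labelling L (ℕ.suc b)} → let open Labelling Λ in
      ∀ {u v} c s → Joins e u v → label u ≡ just (c , s) →
      (label v ≡ just (c , s) ⊎ (∀ t → label v ≢ just (c , t))) →
      Labelling (e ∷ L) b → Attachment L e (ℕ.suc b) Λ

  attach : ∀ L e b (Λ : Labelling L b) → Attachment L e b Λ
  attach L e b Λ = go b Λ (inj₁ ≡.refl) ≡.refl ≡.refl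
    where
    half-labelled : ∀ {b} (Λ : Labelling L (ℕ.suc b)) {u v c s} → let open Labelling Λ in
      Joins e u v → label u ≡ just (c , s) → label v ≡ nothing → Attachment L e (ℕ.suc b) Λ
    half-labelled Λ {u} {v} {c} {s} j lu lv =
      independent c s j lu (inj₂ λ t lv′ → case ≡.trans (≡.sym lv) lv′ of λ ())
        (eliminate-odd Λ j lu
          (conjugate ((e , here ≡.refl , j) ∷ []) (weaken (≡.subst (Anchor L root v) lv (anchor v))))
          (≡.cong (substitute c nothing) lv))
      where
      open Labelling Λ

    go : ∀ b (Λ : Labelling L b) {u v lu lv} → let open Labelling Λ in
      Joins e u v → label u ≡ lu → label v ≡ lv → Attachment L e b Λ
    go b Λ {lu = nothing} {nothing} j lu lv =
      dependent (joins-opposite (Labelling.label Λ) j (≡.trans lu (≡.cong (scale Sign.-) (≡.sym lv))))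
    go (ℕ.suc b) Λ {lu = just _} {nothing} j lu lv = half-labelled Λ j lu lv
    go (ℕ.suc b) Λ {lu = nothing} {just _} j lu lv = half-labelled Λ (swap j) lv lu
    go (ℕ.suc b) Λ {u} {v} {just (c , s)} {just (d , t)} j lu lv with c ≟ d
    ... | no c≢d = independent c s j lu
      (inj₂ λ t lv′ → c≢d (≡.sym (≡.cong proj₁ (just-injective (≡.trans (≡.sym lv) lv′)))))
      (merge Λ j c≢d lu lv)
    -- Within one class, equal signs let `e` close an odd walk, while opposite signs mean that the
    -- column of `e` is already zero in the quotient.
    ... | yes ≡.refl with s Signₚ.≟ t
    ...   | yes ≡.refl = independent c s j lu (inj₁ lv) (eliminate-odd Λ j lu odd odd-v)
      where
      open Labelling Λ
      odd : SignedWalk (e ∷ L) u u Sign.-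
      odd = ≡.subst (SignedWalk _ u u) (Signₚ.opposite[s]*s≡- s)
        (((e , here ≡.refl , j) ∷ weaken (≡.subst (Anchor L root v) lv (anchor v))) ++
          reverse (weaken (≡.subst (Anchor L root u) lu (anchor u))))
      odd-v : substitute c nothing (label v) ≡ nothing
      odd-v rewrite lv | replace-≡ c nothing = ≡.refl
    ...   | no s≢t = dependent (joins-opposite label j (≡.trans lu (≡.trans
      (≡.cong (λ r → just (c , r)) (≢⇒opposite s t s≢t)) (≡.cong (scale Sign.-) (≡.sym lv)))))
      where
      open Labelling Λ
      ≢⇒opposite : ∀ s t → s ≢ t → s ≡ Sign.- Sign.* t
      ≢⇒opposite Sign.+ Sign.+ s≢t = ⊥-elim (s≢t ≡.refl)
      ≢⇒opposite Sign.+ Sign.- s≢t = ≡.refl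
      ≢⇒opposite Sign.- Sign.+ s≢t = ≡.refl
      ≢⇒opposite Sign.- Sign.- s≢t = ⊥-elim (s≢t ≡.refl)

-- Balance and the incidence matrix.

module AlternatingCone {c ℓ₁ ℓ₂ ℓ₃} (ℝ : RealNumbers c ℓ₁ ℓ₂ ℓ₃) (G : Graph) where
  open RealNumbers ℝ
  open OrderedFieldProperties orderedField
  open CommutativeRing commutativeRing
    hiding (Carrier; _≈_; _+_; _*_; -_; _-_; 0#; 1#; zero; +-commutativeMonoid; +-rawMonoid)
  open HeytingField heytingField using (tight)
  open AbelianGroupProperties +-abelianGroup using (xyx⁻¹≈y; ⁻¹-anti-homo‿-; x≈y⇒x∙y⁻¹≈ε; x∙y⁻¹≈ε⇒x≈y)
  open RingProperties ring using (-‿involutive; -0#≈0#; -1*x≈-x)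
  open SemiringSum semiring hiding (sum)
  open CommutativeMonoidSolver +-commutativeMonoid using (solve; _⊕_; _⊜_)
  open SetoidReasoning setoid
  open Graph G

  open DecMembership (_≟_ {#E}) using () renaming (_∈?_ to _∈ᴱ?_)

  infixr 7 _·_
  _·_ : ℕ → Carrier → Carrier
  _·_ = RawMonoidDefinitions._×_ +-rawMonoid

  endSum : (V → Carrier) → E → Carrier
  endSum y e = y (proj₁ (ends e)) + y (proj₂ (ends e))

  signedEndSum : Coloring G → (V → Carrier) → E → Carrier
  signedEndSum C y e = sign (C e) ◃ endSum y e

  -- Balance of red and blue at every vertex, in dual form.
  Balanced : Coloring G → (E → Carrier) → Set (c ⊔ ℓ₁)
  Balanced C x = ∀ y → ⟨ x , signedEndSum C y ⟩ ≈ 0#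

  endSum-joins : ∀ {e u v} → Joins e u v → ∀ y → endSum y e ≈ y u + y v
  endSum-joins (inj₁ eq) y rewrite eq = refl
  endSum-joins (inj₂ eq) y rewrite eq = +-comm _ _

  incidence : (E → Carrier) → V → Carrier
  incidence a v = sum (λ e → if does (incident? v e) then a e else 0#)

  -- The incidence test is a disjunction; it agrees with the sum of the two unit vectors because the
  -- ends of `e` are distinct.
  incident-ends : ∀ a (y : V → Carrier) e →
    sum (λ v → y v * (if does (incident? v e) then a else 0#)) ≈ a * endSum y e
  incident-ends a y e = begin
    sum (λ v → y v * (if does (incident? v e) then a else 0#))  ≈⟨ sum-cong-≋ split ⟩
    sum (λ v → a * (unit u v * y v + unit w v * y v))           ≈⟨ *-distribˡ-sum a (λ v → unit u v * y v + unit w v * y v) ⟨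
    a * sum (λ v → unit u v * y v + unit w v * y v)             ≈⟨ *-congˡ (∑-distrib-+ (λ v → unit u v * y v) (λ v → unit w v * y v)) ⟩
    a * (⟨ unit u , y ⟩ + ⟨ unit w , y ⟩)                       ≈⟨ *-congˡ (+-cong (⟨unit⟩ u y) (⟨unit⟩ w y)) ⟩
    a * endSum y e                                              ∎
    where
    u = proj₁ (ends e)
    w = proj₂ (ends e)

    split : ∀ v → y v * (if does (incident? v e) then a else 0#) ≈ a * (unit u v * y v + unit w v * y v)
    split v with v ≟ u | v ≟ w
    ... | yes ≡.refl | yes v≡w = ⊥-elim (loopless e v≡w)
    ... | yes ≡.refl | no v≢w = begin
      y v * a                                ≈⟨ *-comm (y v) a ⟩
      a * y v                                ≈⟨ *-congˡ (+-identityʳ (y v)) ⟨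
      a * (y v + 0#)                         ≈⟨ *-congˡ (+-cong (*-identityˡ (y v)) (zeroˡ (y v))) ⟨
      a * (1# * y v + 0# * y v)              ≈⟨ *-congˡ (+-cong (*-congʳ (unit-≡ v)) (*-congʳ (unit-≢ (v≢w ∘ ≡.sym)))) ⟨
      a * (unit v v * y v + unit w v * y v)  ∎
    ... | no v≢u | yes ≡.refl = begin
      y v * a                                ≈⟨ *-comm (y v) a ⟩
      a * y v                                ≈⟨ *-congˡ (+-identityˡ (y v)) ⟨
      a * (0# + y v)                         ≈⟨ *-congˡ (+-cong (zeroˡ (y v)) (*-identityˡ (y v))) ⟨
      a * (0# * y v + 1# * y v)              ≈⟨ *-congˡ (+-cong (*-congʳ (unit-≢ (v≢u ∘ ≡.sym))) (*-congʳ (unit-≡ v))) ⟨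
      a * (unit u v * y v + unit v v * y v)  ∎
    ... | no v≢u | no v≢w = begin
      y v * 0#                               ≈⟨ zeroʳ (y v) ⟩
      0#                                     ≈⟨ zeroʳ a ⟨
      a * 0#                                 ≈⟨ *-congˡ (+-identityˡ 0#) ⟨
      a * (0# + 0#)                          ≈⟨ *-congˡ (+-cong (zeroˡ (y v)) (zeroˡ (y v))) ⟨
      a * (0# * y v + 0# * y v)              ≈⟨ *-congˡ (+-cong (*-congʳ (unit-≢ (v≢u ∘ ≡.sym))) (*-congʳ (unit-≢ (v≢w ∘ ≡.sym)))) ⟨
      a * (unit u v * y v + unit w v * y v)  ∎

  -- `endSum` is the transpose of the unsigned incidence matrix: interchange the two sums.
  incidence-adjoint : ∀ a y → ⟨ y , incidence a ⟩ ≈ ⟨ a , endSum y ⟩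
  incidence-adjoint a y = begin
    sum (λ v → y v * sum (λ e → if does (incident? v e) then a e else 0#))    ≈⟨ sum-cong-≋ (λ v → *-distribˡ-sum (y v) (λ e → if does (incident? v e) then a e else 0#)) ⟩
    sum (λ v → sum (λ e → y v * (if does (incident? v e) then a e else 0#)))  ≈⟨ ∑-comm (λ v e → y v * (if does (incident? v e) then a e else 0#)) ⟩
    sum (λ e → sum (λ v → y v * (if does (incident? v e) then a e else 0#)))  ≈⟨ sum-cong-≋ (λ e → incident-ends (a e) y e) ⟩
    ⟨ a , endSum y ⟩                                                          ∎

  incidence-signed : ∀ C x v →
    incidence (λ e → sign (C e) ◃ x e) v ≈ incidentSum G ℝ C red v x - incidentSum G ℝ C blue v x
  incidence-signed C x v = begin
    incidence (λ e → sign (C e) ◃ x e) v                                   ≈⟨ sum-cong-≋ split ⟩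
    sum (λ e → r e + - b e)                                                ≈⟨ ∑-distrib-+ r (λ e → - b e) ⟩
    sum r + sum (λ e → - b e)                                              ≈⟨ +-congˡ (sum-‿- b) ⟩
    incidentSum G ℝ C red v x - incidentSum G ℝ C blue v x                 ∎
    where
    r b : E → Carrier
    r e = if does (incident? v e ×-dec (C e ≟ᶜ red)) then x e else 0#
    b e = if does (incident? v e ×-dec (C e ≟ᶜ blue)) then x e else 0#

    split : ∀ e → (if does (incident? v e) then sign (C e) ◃ x e else 0#) ≈ r e + - b e
    split e with does (incident? v e) | C e
    ... | true  | red  = sym (trans (+-congˡ -0#≈0#) (+-identityʳ _))
    ... | true  | blue = sym (+-identityˡ _)
    ... | false | _    = sym (-‿inverseʳ 0#)

  signed-adjoint : ∀ C x y →
    ⟨ y , (λ v → incidentSum G ℝ C red v x - incidentSum G ℝ C blue v x) ⟩ ≈ ⟨ x , signedEndSum C y ⟩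
  signed-adjoint C x y = begin
    ⟨ y , (λ v → incidentSum G ℝ C red v x - incidentSum G ℝ C blue v x) ⟩  ≈⟨ ⟨⟩-congʳ y (incidence-signed C x) ⟨
    ⟨ y , incidence (λ e → sign (C e) ◃ x e) ⟩                              ≈⟨ incidence-adjoint _ y ⟩
    ⟨ (λ e → sign (C e) ◃ x e) , endSum y ⟩                                 ≈⟨ sum-cong-≋ (λ e → trans (◃-*ˡ (sign (C e)) _ _) (sym (◃-*ʳ (sign (C e)) _ _))) ⟩
    ⟨ x , signedEndSum C y ⟩                                                ∎

  𝒜⇒balanced : ∀ {C x} → x ∈ 𝒜 G ℝ C → Balanced C x
  𝒜⇒balanced {C} {x} (_ , eq) y = trans (sym (signed-adjoint C x y))
    (sum-zero _ λ v → trans (*-congˡ (x≈y⇒x∙y⁻¹≈ε (eq v))) (zeroʳ (y v)))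

  balanced⇒𝒜 : ∀ {C x} → (∀ e → 0# ≤ x e) → Balanced C x → x ∈ 𝒜 G ℝ C
  -- Testing against `unit v` recovers the equation at the vertex `v`.
  balanced⇒𝒜 {C} {x} x≥0 bal = x≥0 , λ v → x∙y⁻¹≈ε⇒x≈y _ _
    (trans (sym (⟨unit⟩ v _)) (trans (signed-adjoint C x (unit v)) (bal (unit v))))

  -- Cuts as dual certificates.

  Cut : Coloring G → E → Set (c ⊔ ℓ₃)
  Cut C e = ∃[ y ] (∀ f → 0# ≤ signedEndSum C y f) × 0# < signedEndSum C y e

  -- The pairing of `x` with the cut is a vanishing sum of nonnegative terms. Were `x e` apart from
  -- zero, its term would be positive; tightness turns this refutation into equality.
  cut⇒zero : ∀ {C e} → Cut C e → ∀ {x} → (∀ f → 0# ≤ x f) → Balanced C x → x e ≈ 0#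
  cut⇒zero {C} {e} (y , y≥0 , ye>0) {x} x≥0 bal = proj₁ (tight (x e) 0#) λ xe#0 →
    <.irrefl (sym (bal y))
      (0<sum _ (λ f → 0≤x*y (x≥0 f) (y≥0 f)) e (*-pos (#0⇒0< (x≥0 e) xe#0) ye>0))

  sum-indicator : ∀ {n} {P : Fin n → Set} (P? : ∀ i → Dec (P i)) →
    length (filter P? (allFin n)) · 1# ≈ sum (λ i → if does (P? i) then 1# else 0#)
  sum-indicator {n} {P} P? = go n (λ i → i)
    where
    go : ∀ k (g : Fin k → Fin n) →
      length (filter P? (tabulate g)) · 1# ≈ sum (λ i → if does (P? (g i)) then 1# else 0#)
    go ℕ.zero    g = refl
    go (ℕ.suc k) g with does (P? (g zero))
    ... | true  = +-congˡ (go k (g ∘ suc))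
    ... | false = trans (go k (g ∘ suc)) (sym (+-identityˡ _))

  redIndicator : Coloring G → E → Carrier
  redIndicator C e = if does (C e ≟ᶜ red) then 1# else 0#

  redDegree-incidence : ∀ C v → redDegree G C v · 1# ≈ incidence (redIndicator C) v
  redDegree-incidence C v =
    trans (sum-indicator (λ e → incident? v e ×-dec (C e ≟ᶜ red))) (sum-cong-≋ split)
    where
    split : ∀ e → (if does (incident? v e ×-dec (C e ≟ᶜ red)) then 1# else 0#) ≈
                  (if does (incident? v e) then redIndicator C e else 0#)
    split e with does (incident? v e)
    ... | true  = refl
    ... | false = refl

  -- The red degrees are the incidence matrix applied to the red indicator, so the difference of the
  -- two indicators lies in the kernel and is orthogonal to every `endSum y`.
  equalDegrees-balanced : ∀ {C C′} → (∀ v → redDegree G C v ≡ redDegree G C′ v) →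
    ∀ y → ⟨ (λ e → redIndicator C e - redIndicator C′ e) , endSum y ⟩ ≈ 0#
  equalDegrees-balanced {C} {C′} eq y = begin
    ⟨ (λ e → redIndicator C e - redIndicator C′ e) , endSum y ⟩              ≈⟨ ⟨⟩-distribʳ-+ (redIndicator C) (λ e → - redIndicator C′ e) (endSum y) ⟩
    ⟨ redIndicator C , endSum y ⟩ + ⟨ (λ e → - redIndicator C′ e) , endSum y ⟩  ≈⟨ +-congˡ (⟨⟩-‿- (redIndicator C′) (endSum y)) ⟩
    ⟨ redIndicator C , endSum y ⟩ - ⟨ redIndicator C′ , endSum y ⟩           ≈⟨ x≈y⇒x∙y⁻¹≈ε same ⟩
    0#                                                                       ∎
    where
    same : ⟨ redIndicator C , endSum y ⟩ ≈ ⟨ redIndicator C′ , endSum y ⟩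
    same = begin
      ⟨ redIndicator C , endSum y ⟩             ≈⟨ incidence-adjoint _ y ⟨
      ⟨ y , incidence (redIndicator C) ⟩        ≈⟨ ⟨⟩-congʳ y (redDegree-incidence C) ⟨
      ⟨ y , (λ v → redDegree G C v · 1#) ⟩      ≈⟨ ⟨⟩-congʳ y (λ v → reflexive (≡.cong (_· 1#) (eq v))) ⟩
      ⟨ y , (λ v → redDegree G C′ v · 1#) ⟩     ≈⟨ ⟨⟩-congʳ y (redDegree-incidence C′) ⟩
      ⟨ y , incidence (redIndicator C′) ⟩       ≈⟨ incidence-adjoint _ y ⟩
      ⟨ redIndicator C′ , endSum y ⟩            ∎

  -- The signed end sums of a cut, added up over the edges on which the two
  -- colorings differ, give zero; hence none of them is positive.
  cut-transfer : ∀ {C C′} → (∀ v → redDegree G C v ≡ redDegree G C′ v) → ∀ {e} → Cut C e → Cut C′ e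
  cut-transfer {C} {C′} eq {e} (y , y≥0 , ye>0) = y , nonneg , pos
    where
    term : E → Carrier
    term f = (redIndicator C f - redIndicator C′ f) * endSum y f

    same-term : ∀ {f} → C f ≡ C′ f → term f ≈ 0#
    same-term {f} Cf≡C′f rewrite Cf≡C′f = trans (*-congʳ (-‿inverseʳ _)) (zeroˡ _)

    other-term : ∀ {f} → C f ≢ C′ f → term f ≈ signedEndSum C y f
    other-term {f} Cf≢C′f with C f | C′ f
    ... | red  | red  = ⊥-elim (Cf≢C′f ≡.refl)
    ... | blue | blue = ⊥-elim (Cf≢C′f ≡.refl)
    ... | red  | blue = trans (*-congʳ (trans (+-congˡ -0#≈0#) (+-identityʳ 1#))) (*-identityˡ _)
    ... | blue | red  = begin
      (0# - 1#) * endSum y f  ≈⟨ *-congʳ (+-identityˡ (- 1#)) ⟩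
      - 1# * endSum y f       ≈⟨ -1*x≈-x _ ⟩
      - endSum y f            ∎

    term≥0 : ∀ f → 0# ≤ term f
    term≥0 f with C f ≟ᶜ C′ f
    ... | yes Cf≡C′f = ≤-reflexive (sym (same-term Cf≡C′f))
    ... | no  Cf≢C′f = 0≤-resp-≈ (sym (other-term Cf≢C′f)) (y≥0 f)

    differ⇒¬pos : ∀ {f} → C f ≢ C′ f → ¬ (0# < signedEndSum C y f)
    differ⇒¬pos {f} Cf≢C′f pos = <.irrefl (sym (equalDegrees-balanced eq y))
      (0<sum term term≥0 f (<.<-respʳ-≈ (sym (other-term Cf≢C′f)) pos))

    flipped : ∀ {κ κ′ a} → κ ≢ κ′ → sign κ′ ◃ a < 0# → 0# < sign κ ◃ a
    flipped {red}  {red}  κ≢κ′ _ = ⊥-elim (κ≢κ′ ≡.refl)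
    flipped {blue} {blue} κ≢κ′ _ = ⊥-elim (κ≢κ′ ≡.refl)
    flipped {red}  {blue} κ≢κ′ -a<0 = -x<0⇒0<x -a<0
    flipped {blue} {red}  κ≢κ′ a<0 = x<0⇒0<-x a<0

    nonneg : ∀ f → 0# ≤ signedEndSum C′ y f
    nonneg f with C f ≟ᶜ C′ f
    ... | yes Cf≡C′f = ≡.subst (λ κ → 0# ≤ sign κ ◃ endSum y f) Cf≡C′f (y≥0 f)
    -- The sign changes with the color, so a negative value for `C′` would be a positive one for
    -- `C`.
    ... | no  Cf≢C′f = differ⇒¬pos Cf≢C′f ∘ flipped Cf≢C′f

    pos : 0# < signedEndSum C′ y e
    pos with C e ≟ᶜ C′ e
    ... | yes Ce≡C′e = ≡.subst (λ κ → 0# < sign κ ◃ endSum y e) Ce≡C′e ye>0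
    ... | no  Ce≢C′e = ⊥-elim (differ⇒¬pos Ce≢C′e ye>0)

  module _ (C : Coloring G) where
    open AlternatingWalks G C

    -- Each edge gives two arcs, one per direction, and its signed end sum is the total increase of
    -- the indicator of `S` along them. A closed set allows no decrease, and one of the arcs of `e`
    -- enters `S`.
    closedSet⇒cut : ∀ (S : Node → Bool) → (∀ {p q} → S p ≡ true → Arc p q → S q ≡ true) →
      ∀ e → S (proj₂ (ends e) , oppositeᶜ (C e)) ≡ true → S (proj₁ (ends e) , C e) ≡ false → Cut C e
    closedSet⇒cut S stable e head∈S tail∉S = y , nonneg ,
      <.<-respʳ-≈ (sym (split e)) (0<x+y pos (arc≥0 (e , inj₂ ≡.refl , ≡.refl , ≡.refl)))
      where
      ind : Node → Carrier
      ind p = if S p then 1# else 0#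

      -- With this choice, multiplying by the sign of `κ` gives the indicator at the color opposite
      -- to `κ` minus that at `κ`, for both colors.
      y : V → Carrier
      y v = ind (v , blue) - ind (v , red)

      signed : ∀ κ v → sign κ ◃ y v ≈ ind (v , oppositeᶜ κ) - ind (v , κ)
      signed red  v = refl
      signed blue v = ⁻¹-anti-homo‿- (ind (v , blue)) (ind (v , red))

      split : ∀ f → signedEndSum C y f ≈
        (ind (proj₂ (ends f) , oppositeᶜ (C f)) - ind (proj₁ (ends f) , C f)) +
        (ind (proj₁ (ends f) , oppositeᶜ (C f)) - ind (proj₂ (ends f) , C f))
      split f = begin
        signedEndSum C y f
          ≈⟨ ◃-distrib-+ (sign (C f)) _ _ ⟩
        sign (C f) ◃ y (proj₁ (ends f)) + sign (C f) ◃ y (proj₂ (ends f))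
          ≈⟨ +-cong (signed (C f) _) (signed (C f) _) ⟩
        (ind (proj₁ (ends f) , oppositeᶜ (C f)) - ind (proj₁ (ends f) , C f)) +
        (ind (proj₂ (ends f) , oppositeᶜ (C f)) - ind (proj₂ (ends f) , C f))
          ≈⟨ solve 4 (λ a b c d → (a ⊕ b) ⊕ (c ⊕ d) ⊜ (c ⊕ b) ⊕ (a ⊕ d)) refl _ _ _ _ ⟩
        (ind (proj₂ (ends f) , oppositeᶜ (C f)) - ind (proj₁ (ends f) , C f)) +
        (ind (proj₁ (ends f) , oppositeᶜ (C f)) - ind (proj₂ (ends f) , C f)) ∎

      arc≥0 : ∀ {p q} → Arc p q → 0# ≤ ind q - ind p
      arc≥0 {p} {q} arc with S p in Sp | S q in Sq
      ... | true  | true  = ≤-reflexive (sym (-‿inverseʳ 1#))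
      ... | false | true  = 0≤-resp-≈ (sym (trans (+-congˡ -0#≈0#) (+-identityʳ 1#))) (<⇒≤ 0<1)
      ... | false | false = ≤-reflexive (sym (-‿inverseʳ 0#))
      ... | true  | false with ≡.trans (≡.sym Sq) (stable Sp arc)
      ...   | ()

      nonneg : ∀ f → 0# ≤ signedEndSum C y f
      nonneg f = 0≤-resp-≈ (sym (split f)) (0≤x+y
        (arc≥0 (f , inj₁ ≡.refl , ≡.refl , ≡.refl)) (arc≥0 (f , inj₂ ≡.refl , ≡.refl , ≡.refl)))

      pos : 0# < ind (proj₂ (ends e) , oppositeᶜ (C e)) - ind (proj₁ (ends e) , C e)
      pos rewrite head∈S | tail∉S = <.<-respʳ-≈ (sym (trans (+-congˡ -0#≈0#) (+-identityʳ 1#))) 0<1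

    dichotomy : ∀ e → OnCAW e ⊎ Cut C e
    dichotomy e with onCAW-or-cut e
    ... | inj₁ caw = inj₁ caw
    ... | inj₂ (S , stable , head∈S , tail∉S) = inj₂ (closedSet⇒cut S stable e head∈S tail∉S)

  -- Edge multiplicities of closed alternating walks.

  multiplicity : List E → E → Carrier
  multiplicity []       f = 0#
  multiplicity (e ∷ es) f = unit e f + multiplicity es f

  multiplicity≥0 : ∀ es f → 0# ≤ multiplicity es f
  multiplicity≥0 []       f = ≤-reflexive refl
  multiplicity≥0 (e ∷ es) f = 0≤x+y (unit≥0 e f) (multiplicity≥0 es f)

  -- The lower bound is kept as a nonnegative difference, the form that can later be multiplied by a
  -- nonnegative constant.
  multiplicity≥1 : ∀ {es f} → f ∈ˡ es → 0# ≤ multiplicity es f - 1#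
  multiplicity≥1 {e ∷ es} {f} (here ≡.refl) =
    0≤-resp-≈ (sym eq) (multiplicity≥0 es f)
    where
    eq : unit e e + multiplicity es e - 1# ≈ multiplicity es e
    eq = trans (+-congʳ (+-congʳ (unit-≡ e)))
      (xyx⁻¹≈y 1# (multiplicity es e))
  multiplicity≥1 {e ∷ es} {f} (there f∈es) =
    0≤-resp-≈ (sym (+-assoc _ _ _)) (0≤x+y (unit≥0 e f) (multiplicity≥1 f∈es))

  ⟨multiplicity⟩-∷ : ∀ e es g → ⟨ multiplicity (e ∷ es) , g ⟩ ≈ g e + ⟨ multiplicity es , g ⟩
  ⟨multiplicity⟩-∷ e es g = trans (⟨⟩-distribʳ-+ (unit e) (multiplicity es) g) (+-congʳ (⟨unit⟩ e g))

  differentSigns : ∀ {κ κ′} → κ ≢ κ′ → ∀ a → sign κ ◃ a + sign κ′ ◃ a ≈ 0#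
  differentSigns {red}  {red}  κ≢κ′ a = ⊥-elim (κ≢κ′ ≡.refl)
  differentSigns {blue} {blue} κ≢κ′ a = ⊥-elim (κ≢κ′ ≡.refl)
  differentSigns {red}  {blue} κ≢κ′ a = -‿inverseʳ a
  differentSigns {blue} {red}  κ≢κ′ a = -‿inverseˡ a

  -- At an inner vertex the two consecutive edges have different colors, so their contributions
  -- cancel and only the two ends of the walk remain. The first edge is split off to make the walk
  -- nonempty.
  telescope : ∀ {C u v t e} → Joins e u v → (w : Walk v t) → Linked (λ e f → C e ≢ C f) (e ∷ edges w) →
    ∃[ f ] last (e ∷ edges w) ≡ just f ×
      (∀ y → ⟨ multiplicity (e ∷ edges w) , signedEndSum C y ⟩ ≈ sign (C e) ◃ y u + sign (C f) ◃ y t)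
  telescope {C} {u} {v} {e = e} j [] _ = e , ≡.refl , λ y → begin
    ⟨ multiplicity (e ∷ []) , signedEndSum C y ⟩           ≈⟨ ⟨multiplicity⟩-∷ e [] (signedEndSum C y) ⟩
    signedEndSum C y e + ⟨ (λ _ → 0#) , signedEndSum C y ⟩ ≈⟨ +-congˡ (⟨⟩-zeroˡ (signedEndSum C y)) ⟩
    signedEndSum C y e + 0#                                ≈⟨ +-identityʳ _ ⟩
    signedEndSum C y e                                     ≈⟨ ◃-cong (sign (C e)) (endSum-joins j y) ⟩
    sign (C e) ◃ (y u + y v)                               ≈⟨ ◃-distrib-+ (sign (C e)) (y u) (y v) ⟩
    sign (C e) ◃ y u + sign (C e) ◃ y v                    ∎
  telescope {C} {u} {v} {t} {e} j (step e′ j′ w) (Ce≢Ce′ ∷ linked) with telescope {C} j′ w linked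
  ... | f , last≡f , ih = f , last≡f , λ y → begin
    ⟨ multiplicity (e ∷ e′ ∷ edges w) , signedEndSum C y ⟩
      ≈⟨ ⟨multiplicity⟩-∷ e (e′ ∷ edges w) (signedEndSum C y) ⟩
    signedEndSum C y e + ⟨ multiplicity (e′ ∷ edges w) , signedEndSum C y ⟩
      ≈⟨ +-cong (trans (◃-cong (sign (C e)) (endSum-joins j y)) (◃-distrib-+ (sign (C e)) (y u) (y v))) (ih y) ⟩
    (sign (C e) ◃ y u + sign (C e) ◃ y v) + (sign (C e′) ◃ y v + sign (C f) ◃ y t)
      ≈⟨ solve 4 (λ a b c d → (a ⊕ b) ⊕ (c ⊕ d) ⊜ a ⊕ ((b ⊕ c) ⊕ d)) refl _ _ _ _ ⟩
    sign (C e) ◃ y u + ((sign (C e) ◃ y v + sign (C e′) ◃ y v) + sign (C f) ◃ y t)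
      ≈⟨ +-congˡ (+-congʳ (differentSigns Ce≢Ce′ (y v))) ⟩
    sign (C e) ◃ y u + (0# + sign (C f) ◃ y t)
      ≈⟨ +-congˡ (+-identityˡ _) ⟩
    sign (C e) ◃ y u + sign (C f) ◃ y t ∎

  CAW-balanced : ∀ {C v} (w : Walk v v) → IsCAW G C w → Balanced C (multiplicity (edges w))
  CAW-balanced {C} [] _ y = ⟨⟩-zeroˡ (signedEndSum C y)
  CAW-balanced {C} {v} (step e j w) (linked , connected) y with telescope {C} j w linked
  -- The two remaining terms belong to the same vertex, and the closing condition gives them
  -- opposite signs.
  ... | f , last≡f , eq with last (edges (step e j w)) | connected | last≡f
  ...   | _ | just Cf≢Ce | ≡.refl = trans (eq y) (differentSigns (Cf≢Ce ∘ ≡.sym) (y v))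

  -- By balance of the multiplicities of a closed alternating walk, no edge of
  -- the walk is in a cut.
  E-of⇒¬cut : ∀ {C d} → C ∈ 𝒦 G d → ∀ {e} → e ∈ E-of G d → ¬ Cut C e
  E-of⇒¬cut C∈𝒦 {e} (C′ , C′∈𝒦 , v , w , caw , e∈w) cut =
    multiplicity≥1 e∈w (<.<-respˡ-≈ (sym eq) -1<0)
    where
    eq : multiplicity (edges w) e - 1# ≈ - 1#
    eq = trans (+-congʳ (cut⇒zero {C′}
      (cut-transfer {C′ = C′} (λ v → ≡.trans (C∈𝒦 v) (≡.sym (C′∈𝒦 v))) cut)
      (multiplicity≥0 (edges w)) (CAW-balanced w caw)))
      (+-identityˡ _)

    -1<0 : - 1# < 0#
    -1<0 = <.<-respʳ-≈ (-‿inverseʳ 1#) (<.<-respˡ-≈ (+-identityˡ (- 1#)) (+-monoˡ-< (- 1#) 0<1))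

  -- Membership quantifies over all colorings and walks, yet the dichotomy for the single coloring
  -- `C` decides it, since a cut of `C` excludes it.
  E-of? : ∀ {C d} → C ∈ 𝒦 G d → ∀ e → Dec (e ∈ E-of G d)
  E-of? {C} C∈𝒦 e with dichotomy C e
  ... | inj₁ onCAW = yes (C , C∈𝒦 , onCAW)
  ... | inj₂ cut   = no λ e∈ → E-of⇒¬cut C∈𝒦 e∈ cut

  -- No maximum can be selected by comparison here, so the Archimedean bounds of the single entries
  -- are added up.
  bounded-below : ∀ {n} (x : Fin n → Carrier) → ∃[ M ] 0# ≤ M × (∀ i → 0# ≤ x i + M)
  bounded-below {ℕ.zero}  x = 0# , ≤-reflexive refl , λ ()
  bounded-below {ℕ.suc n} x with bounded-below (x ∘ suc) | archimedean (- x zero)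
  ... | M , M≥0 , x+M≥0 | k , -x₀<k = k · 1# + M , 0≤x+y (k·1≥0 k) M≥0 , λ
    { zero    → 0≤-resp-≈ (+-assoc _ _ _) (0≤x+y (<⇒≤ 0<x₀+k) M≥0)
    ; (suc i) → 0≤-resp-≈ (solve 3 (λ a b c → (a ⊕ b) ⊕ c ⊜ a ⊕ (c ⊕ b)) refl _ _ _)
                  (0≤x+y (x+M≥0 i) (k·1≥0 k))
    }
    where
    k·1≥0 : ∀ k → 0# ≤ k · 1#
    k·1≥0 ℕ.zero    = ≤-reflexive refl
    k·1≥0 (ℕ.suc k) = 0≤x+y (<⇒≤ 0<1) (k·1≥0 k)

    0<x₀+k : 0# < x zero + k · 1#
    0<x₀+k = <.<-respˡ-≈ (-‿inverseˡ (x zero)) (<.<-respʳ-≈ (+-comm _ _) (+-monoˡ-< (x zero) -x₀<k))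

  -- Circulations and the span of the cone.

  module _ (C : Coloring G) where
    open Dimension ℝ {#E}
    open AlternatingWalks G C using (OnCAW)

    Circulation : List E → Pred (E → Carrier) (c ⊔ ℓ₁)
    Circulation L x = (∀ {e} → e ∉ˡ L → x e ≈ 0#) × Balanced C x

    balanced-+ : ∀ {x y} → Balanced C x → Balanced C y → Balanced C (λ e → x e + y e)
    balanced-+ {x} {y} bx by z = trans (⟨⟩-distribʳ-+ x y (signedEndSum C z))
      (trans (+-cong (bx z) (by z)) (+-identityˡ 0#))

    balanced-* : ∀ a {x} → Balanced C x → Balanced C (λ e → a * x e)
    balanced-* a {x} bx z = trans (⟨⟩-*ˡ a x (signedEndSum C z)) (trans (*-congˡ (bx z)) (zeroʳ a))

    -- One closed alternating walk per edge of `L` is added; multiplicities are nonnegative, so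
    -- later additions preserve the bound on earlier edges.
    positiveCirculation : ∀ L → (∀ {e} → e ∈ˡ L → OnCAW e) →
      ∃[ z ] (∀ e → 0# ≤ z e) × Balanced C z × (∀ {e} → e ∈ˡ L → 0# ≤ z e - 1#)
    positiveCirculation [] _ =
      (λ _ → 0#) , (λ _ → ≤-reflexive refl) , (λ y → ⟨⟩-zeroˡ (signedEndSum C y)) , λ ()
    positiveCirculation (e ∷ L) onCAW with onCAW (here ≡.refl) | positiveCirculation L (onCAW ∘ there)
    ... | v , w , caw , e∈w | z , z≥0 , z-balanced , z≥1 =
      (λ f → multiplicity (edges w) f + z f) ,
      (λ f → 0≤x+y (multiplicity≥0 (edges w) f) (z≥0 f)) ,
      balanced-+ (CAW-balanced w caw) z-balanced , λ
      { (here ≡.refl) → 0≤-resp-≈ (solve 3 (λ a b c → (a ⊕ b) ⊕ c ⊜ (a ⊕ c) ⊕ b) refl _ _ _)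
                          (0≤x+y (multiplicity≥1 e∈w) (z≥0 e))
      ; (there f∈L)   → 0≤-resp-≈ (sym (+-assoc _ _ _)) (0≤x+y (multiplicity≥0 (edges w) _) (z≥1 f∈L))
      }

    -- Both conditions on a circulation are linear, and the generators meet them: they are balanced,
    -- and they vanish on the cut edges outside `L`.
    span⇒circulation : ∀ {L} → (∀ {e} → e ∉ˡ L → Cut C e) → ∀ {x} → x ∈ Span (𝒜 G ℝ C) → x ∈ Circulation L
    span⇒circulation {L} cut {x} (k , a , v , v∈𝒜 , x≋) = outside , balanced
      where
      outside : ∀ {e} → e ∉ˡ L → x e ≈ 0#
      outside {e} e∉L = trans (x≋ e) (sum-zero (λ i → a i * v i e) λ i →
        trans (*-congˡ (cut⇒zero {C} (cut e∉L) (proj₁ (v∈𝒜 i)) (𝒜⇒balanced {C} (v∈𝒜 i)))) (zeroʳ (a i)))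

      balanced : Balanced C x
      balanced y = begin
        ⟨ x , signedEndSum C y ⟩                         ≈⟨ ⟨⟩-congˡ (signedEndSum C y) x≋ ⟩
        ⟨ lincomb a v , signedEndSum C y ⟩               ≈⟨ ⟨⟩-lincomb a v (signedEndSum C y) ⟩
        sum (λ i → a i * ⟨ v i , signedEndSum C y ⟩)     ≈⟨ sum-zero _ (λ i → trans (*-congˡ (𝒜⇒balanced {C} (v∈𝒜 i) y)) (zeroʳ (a i))) ⟩
        0#                                               ∎

    -- x = (x + M z) - M z, where z is positive on L and M is large.
    circulation⇒span : ∀ {L} → (∀ {e} → e ∈ˡ L → OnCAW e) → ∀ {x} → x ∈ Circulation L → x ∈ Span (𝒜 G ℝ C)
    circulation⇒span {L} onCAW {x} (outside , balanced) with positiveCirculation L onCAW | bounded-below x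
    ... | z , z≥0 , z-balanced , z≥1 | M , M≥0 , x+M≥0 =
      2 , 1# ∷ᵛ - 1# ∷ᵛ []ᵛ , shifted ∷ᵛ Mz ∷ᵛ []ᵛ , member , decomposition
      where
      Mz shifted : E → Carrier
      Mz e      = M * z e
      shifted e = x e + Mz e

      Mz≥0 : ∀ e → 0# ≤ Mz e
      Mz≥0 e = 0≤x*y M≥0 (z≥0 e)

      shifted≥0 : ∀ e → 0# ≤ shifted e
      shifted≥0 e with e ∈ᴱ? L
      ... | no  e∉L = 0≤x+y (≤-reflexive (sym (outside e∉L))) (Mz≥0 e)
      -- Here `x e + M * z e` is written as `(x e + M) + M * (z e - 1#)`, a sum of two nonnegative
      -- terms.
      ... | yes e∈L = 0≤-resp-≈ eq (0≤x+y (x+M≥0 e) (0≤x*y M≥0 (z≥1 e∈L)))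
        where
        eq : (x e + M) + M * (z e - 1#) ≈ shifted e
        eq = begin
          (x e + M) + M * (z e - 1#)  ≈⟨ +-assoc _ _ _ ⟩
          x e + (M + M * (z e - 1#))  ≈⟨ +-congˡ (+-congʳ (*-identityʳ M)) ⟨
          x e + (M * 1# + M * (z e - 1#))  ≈⟨ +-congˡ (distribˡ M 1# (z e - 1#)) ⟨
          x e + M * (1# + (z e - 1#))  ≈⟨ +-congˡ (*-congˡ (trans (sym (+-assoc 1# (z e) (- 1#))) (xyx⁻¹≈y 1# (z e)))) ⟩
          shifted e                   ∎

      member : ∀ i → (shifted ∷ᵛ Mz ∷ᵛ []ᵛ) i ∈ 𝒜 G ℝ C
      member zero       = balanced⇒𝒜 {C} shifted≥0 (balanced-+ balanced (balanced-* M z-balanced))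
      member (suc zero) = balanced⇒𝒜 {C} Mz≥0 (balanced-* M z-balanced)

      decomposition : ∀ e → x e ≈ 1# * shifted e + (- 1# * Mz e + 0#)
      decomposition e = sym (begin
        1# * shifted e + (- 1# * Mz e + 0#)  ≈⟨ +-cong (*-identityˡ _) (trans (+-identityʳ _) (-1*x≈-x (Mz e))) ⟩
        x e + Mz e - Mz e                    ≈⟨ +-assoc _ _ _ ⟩
        x e + (Mz e - Mz e)                  ≈⟨ +-congˡ (-‿inverseʳ (Mz e)) ⟩
        x e + 0#                             ≈⟨ +-identityʳ (x e) ⟩
        x e                                  ∎)

    -- A basis of the circulation space.

    open ComponentLabels G

    -- The vector is an alternating sum along the walk. The sign of the color of each edge is put in
    -- to undo the one in `signedEndSum`, so that the inner vertices cancel.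
    signedWalk-vector : ∀ {L u v s} → SignedWalk L u v s → ∃[ w ] (∀ {e} → e ∉ˡ L → w e ≈ 0#) ×
      (∀ y → ⟨ w , signedEndSum C y ⟩ ≈ y u - s ◃ y v)
    signedWalk-vector {v = v} [] = (λ _ → 0#) , (λ _ → refl) , λ y →
      trans (⟨⟩-zeroˡ (signedEndSum C y)) (sym (-‿inverseʳ (y v)))
    signedWalk-vector {L} {u} {t} (_∷_ {v = v} {s = s} (e , e∈L , j) p) with signedWalk-vector p
    ... | w , outside , boundary = (λ f → σ ◃ unit e f - w f) , outside′ , boundary′
      where
      σ = sign (C e)

      outside′ : ∀ {f} → f ∉ˡ L → σ ◃ unit e f - w f ≈ 0#
      outside′ {f} f∉L = trans (+-cong
        (trans (◃-cong σ (unit-≢ {i = e} {f} λ { ≡.refl → f∉L e∈L })) (◃-0# σ))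
        (trans (-‿cong (outside f∉L)) -0#≈0#)) (+-identityˡ 0#)

      boundary′ : ∀ y → ⟨ (λ f → σ ◃ unit e f - w f) , signedEndSum C y ⟩ ≈ y u - opposite s ◃ y t
      boundary′ y = begin
        ⟨ (λ f → σ ◃ unit e f - w f) , g ⟩                  ≈⟨ ⟨⟩-distribʳ-+ (λ f → σ ◃ unit e f) (λ f → - w f) g ⟩
        ⟨ (λ f → σ ◃ unit e f) , g ⟩ + ⟨ (λ f → - w f) , g ⟩  ≈⟨ +-cong (trans (⟨⟩-◃ σ (unit e) g) (◃-cong σ (⟨unit⟩ e g))) (⟨⟩-‿- w g) ⟩
        σ ◃ σ ◃ endSum y e - ⟨ w , g ⟩                      ≈⟨ +-cong (trans (◃-selfInverse σ _) (endSum-joins j y)) (-‿cong (boundary y)) ⟩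
        y u + y v - (y v - s ◃ y t)                         ≈⟨ +-congˡ (⁻¹-anti-homo‿- (y v) (s ◃ y t)) ⟩
        y u + y v + (s ◃ y t - y v)                         ≈⟨ solve 4 (λ a b c d → (a ⊕ b) ⊕ (c ⊕ d) ⊜ (a ⊕ c) ⊕ (b ⊕ d)) refl _ _ _ _ ⟩
        (y u + s ◃ y t) + (y v - y v)                       ≈⟨ trans (+-congˡ (-‿inverseʳ (y v))) (+-identityʳ _) ⟩
        y u + s ◃ y t                                       ≈⟨ +-congˡ (trans (-‿cong (opposite-◃ s (y t))) (-‿involutive _)) ⟨
        y u - opposite s ◃ y t                              ∎
        where g = signedEndSum C y

    -- Up to color signs, `w` writes the incidence column of an edge between `u` and `v` as a
    -- combination of the columns of `L`.
    Represents : List E → V → V → (E → Carrier) → Set (c ⊔ ℓ₁)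
    Represents L u v w = (∀ {e} → e ∉ˡ L → w e ≈ 0#) × (∀ y → ⟨ w , signedEndSum C y ⟩ ≈ y u + y v)

    oddWalk-represents : ∀ {L u v} → SignedWalk L u v Sign.- → ∃[ w ] Represents L u v w
    oddWalk-represents p with signedWalk-vector p
    ... | w , outside , boundary = w , outside , λ y → trans (boundary y) (+-congˡ (-‿involutive _))

    -- If the labels are opposite signs of one class, the walk from `u` through the root to `v` is
    -- odd. If both are zero, the odd closed walks at `u` and at `v` represent twice each unit
    -- vector, and half their sum is taken.
    dependent-represents : ∀ {L b} (Λ : Labelling L b) → let open Labelling Λ in
      ∀ {u v} → label u ≡ scale Sign.- (label v) → ∃[ w ] Represents L u v w
    dependent-represents {L} Λ {u} {v} opp = go (label u) (label v) opp (anchor u) (anchor v)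
      where
      open Labelling Λ

      same-root : ∀ t → Sign.- Sign.* t Sign.* t ≡ Sign.-
      same-root Sign.+ = ≡.refl
      same-root Sign.- = ≡.refl

      go : ∀ lu lv → lu ≡ scale Sign.- lv → Anchor L root u lu → Anchor L root v lv → ∃[ w ] Represents L u v w
      go _ (just (c , t)) ≡.refl p q =
        oddWalk-represents (≡.subst (SignedWalk L u v) (same-root t) (p ++ reverse q))
      go _ nothing ≡.refl p q with oddWalk-represents p | oddWalk-represents q
      ... | w , w-outside , w-boundary | w′ , w′-outside , w′-boundary =
        (λ e → ½ * (w e + w′ e)) ,
        (λ e∉L → trans (*-congˡ (trans (+-cong (w-outside e∉L) (w′-outside e∉L)) (+-identityˡ 0#))) (zeroʳ ½)) ,
        λ y → begin
          ⟨ (λ e → ½ * (w e + w′ e)) , signedEndSum C y ⟩    ≈⟨ ⟨⟩-*ˡ ½ (λ e → w e + w′ e) (signedEndSum C y) ⟩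
          ½ * ⟨ (λ e → w e + w′ e) , signedEndSum C y ⟩      ≈⟨ *-congˡ (⟨⟩-distribʳ-+ w w′ (signedEndSum C y)) ⟩
          ½ * (⟨ w , signedEndSum C y ⟩ + ⟨ w′ , signedEndSum C y ⟩)  ≈⟨ *-congˡ (+-cong (w-boundary y) (w′-boundary y)) ⟩
          ½ * ((y u + y u) + (y v + y v))                    ≈⟨ *-congˡ (solve 2 (λ a b → (a ⊕ a) ⊕ (b ⊕ b) ⊜ (a ⊕ b) ⊕ (a ⊕ b)) refl _ _) ⟩
          ½ * ((y u + y v) + (y u + y v))                    ≈⟨ ½[x+x]≈x (y u + y v) ⟩
          y u + y v                                          ∎

    -- The new vector `x₀` is 1 at `e`, where all old basis vectors vanish. Hence its coefficient in
    -- any combination is the value at `e`, and subtracting that multiple leaves a circulation on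
    -- `L`.
    basis-extend : ∀ {L e k b} → e ∉ˡ L → ∃[ w ] Represents L (proj₁ (ends e)) (proj₂ (ends e)) w →
      IsBasisOf {k} b (Circulation L) → ∃[ b′ ] IsBasisOf {ℕ.suc k} b′ (Circulation (e ∷ L))
    basis-extend {L} {e} {k} {b} e∉L (w , outside , boundary) (b∈ , b-independent , spanning) =
      b′ , b′∈ , independent′ , spanning′
      where
      σ = sign (C e)

      x₀ : E → Carrier
      x₀ f = unit e f - σ ◃ w f

      b′ : Fin (ℕ.suc k) → E → Carrier
      b′ = x₀ ∷ᵛ b

      x₀-e : x₀ e ≈ 1#
      x₀-e = trans (+-cong (unit-≡ e) (-‿cong (trans (◃-cong σ (outside e∉L)) (◃-0# σ))))
        (trans (+-congˡ -0#≈0#) (+-identityʳ 1#))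

      x₀-outside : ∀ {f} → f ∉ˡ e ∷ L → x₀ f ≈ 0#
      x₀-outside {f} f∉ = trans (+-cong (unit-≢ {i = e} {f} λ { ≡.refl → f∉ (here ≡.refl) })
        (-‿cong (trans (◃-cong σ (outside (f∉ ∘ there))) (◃-0# σ)))) (-‿inverseʳ 0#)

      x₀-balanced : Balanced C x₀
      x₀-balanced y = begin
        ⟨ x₀ , g ⟩                                      ≈⟨ ⟨⟩-distribʳ-+ (unit e) (λ f → - (σ ◃ w f)) g ⟩
        ⟨ unit e , g ⟩ + ⟨ (λ f → - (σ ◃ w f)) , g ⟩    ≈⟨ +-cong (⟨unit⟩ e g) (⟨⟩-‿- (λ f → σ ◃ w f) g) ⟩
        g e - ⟨ (λ f → σ ◃ w f) , g ⟩                   ≈⟨ +-congˡ (-‿cong (trans (⟨⟩-◃ σ w g) (◃-cong σ (boundary y)))) ⟩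
        g e - g e                                       ≈⟨ -‿inverseʳ (g e) ⟩
        0#                                              ∎
        where g = signedEndSum C y

      b′∈ : ∀ i → b′ i ∈ Circulation (e ∷ L)
      b′∈ zero    = x₀-outside , x₀-balanced
      b′∈ (suc i) = (λ f∉ → proj₁ (b∈ i) (f∉ ∘ there)) , proj₂ (b∈ i)

      lincomb-e : ∀ a → lincomb a b′ e ≈ a zero
      lincomb-e a = begin
        a zero * x₀ e + sum (λ i → a (suc i) * b i e)  ≈⟨ +-cong (*-congˡ x₀-e) (sum-zero _ λ i →
                                                           trans (*-congˡ (proj₁ (b∈ i) e∉L)) (zeroʳ (a (suc i)))) ⟩
        a zero * 1# + 0#                               ≈⟨ trans (+-identityʳ _) (*-identityʳ _) ⟩
        a zero                                         ∎

      independent′ : LinearlyIndependent b′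
      independent′ a a≋0 = λ { zero → a₀≈0 ; (suc i) → b-independent (a ∘ suc) rest i }
        where
        a₀≈0 : a zero ≈ 0#
        a₀≈0 = trans (sym (lincomb-e a)) (a≋0 e)

        rest : ∀ f → lincomb (a ∘ suc) b f ≈ 0#
        rest f = begin
          lincomb (a ∘ suc) b f                   ≈⟨ +-identityˡ _ ⟨
          0# + lincomb (a ∘ suc) b f              ≈⟨ +-congʳ (trans (*-congʳ a₀≈0) (zeroˡ (x₀ f))) ⟨
          a zero * x₀ f + lincomb (a ∘ suc) b f   ≈⟨ a≋0 f ⟩
          0#                                      ∎

      spanning′ : ∀ x → x ∈ Circulation (e ∷ L) → ∃[ a ] (x ≋ lincomb a b′)
      spanning′ x (x-outside , x-balanced) with spanning (λ f → x f - x e * x₀ f) (outside′ , balanced′)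
        where
        outside′ : ∀ {f} → f ∉ˡ L → x f - x e * x₀ f ≈ 0#
        outside′ {f} f∉L with f ≟ e
        ... | yes ≡.refl = trans (+-congˡ (-‿cong (trans (*-congˡ x₀-e) (*-identityʳ (x e))))) (-‿inverseʳ (x e))
        ... | no  f≢e    = trans (+-cong (x-outside f∉) (-‿cong (trans (*-congˡ (x₀-outside f∉)) (zeroʳ (x e))))) (-‿inverseʳ 0#)
          where
          f∉ : f ∉ˡ e ∷ L
          f∉ (here f≡e)  = f≢e f≡e
          f∉ (there f∈L) = f∉L f∈L

        balanced′ : Balanced C (λ f → x f - x e * x₀ f)
        balanced′ y = begin
          ⟨ (λ f → x f - x e * x₀ f) , g ⟩                 ≈⟨ ⟨⟩-distribʳ-+ x (λ f → - (x e * x₀ f)) g ⟩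
          ⟨ x , g ⟩ + ⟨ (λ f → - (x e * x₀ f)) , g ⟩       ≈⟨ +-cong (x-balanced y) (⟨⟩-‿- (λ f → x e * x₀ f) g) ⟩
          0# - ⟨ (λ f → x e * x₀ f) , g ⟩                  ≈⟨ +-congˡ (-‿cong (balanced-* (x e) x₀-balanced y)) ⟩
          0# - 0#                                          ≈⟨ -‿inverseʳ 0# ⟩
          0#                                               ∎
          where g = signedEndSum C y
      ... | a , eq = x e ∷ᵛ a , λ f → begin
        x f                                      ≈⟨ +-identityʳ (x f) ⟨
        x f + 0#                                 ≈⟨ +-congˡ (-‿inverseˡ (x e * x₀ f)) ⟨
        x f + (- (x e * x₀ f) + x e * x₀ f)      ≈⟨ +-assoc _ _ _ ⟨
        (x f - x e * x₀ f) + x e * x₀ f          ≈⟨ +-congʳ (eq f) ⟩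
        lincomb a b f + x e * x₀ f               ≈⟨ +-comm _ _ ⟩
        x e * x₀ f + lincomb a b f               ∎

    -- Pairing a circulation `x` on `e ∷ L` with the potential `y` leaves only the term at `e`,
    -- whose second factor is apart from zero; so `x e` vanishes and nothing new arises.
    basis-keep : ∀ {L e k b} → ∃[ y ] (∀ {f} → f ∈ˡ L → endSum y f ≈ 0#) × endSum y e # 0# →
      IsBasisOf {k} b (Circulation L) → IsBasisOf {k} b (Circulation (e ∷ L))
    basis-keep {L} {e} {b = b} (y , y≈0 , ye#0) (b∈ , b-independent , spanning) =
      (λ i → (λ f∉ → proj₁ (b∈ i) (f∉ ∘ there)) , proj₂ (b∈ i)) , b-independent , λ x x∈ → spanning x (restrict x x∈)
      where
      restrict : ∀ x → x ∈ Circulation (e ∷ L) → x ∈ Circulation L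
      restrict x (outside , balanced) = outside′ , balanced
        where
        others : ∀ f → f ≢ e → x f * signedEndSum C y f ≈ 0#
        others f f≢e with f ∈ᴱ? L
        ... | yes f∈L = trans (*-congˡ (trans (◃-cong (sign (C f)) (y≈0 f∈L)) (◃-0# (sign (C f))))) (zeroʳ (x f))
        ... | no  f∉L = trans (*-congʳ (outside λ { (here f≡e) → f≢e f≡e ; (there f∈L) → f∉L f∈L })) (zeroˡ _)

        xe≈0 : x e ≈ 0#
        xe≈0 = x*y≈0∧y#0⇒x≈0 (trans (sym (sum-single _ e others)) (balanced y)) (◃-#0 (sign (C e)) ye#0)

        outside′ : ∀ {f} → f ∉ˡ L → x f ≈ 0#
        outside′ {f} f∉L with f ≟ e
        ... | yes ≡.refl = xe≈0
        ... | no  f≢e    = outside λ { (here f≡e) → f≢e f≡e ; (there f∈L) → f∉L f∈L }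

    -- The coordinate functional of class `c` on the quotient.
    coefficient : ∀ {b} → Fin b → Label b → Carrier
    coefficient c nothing        = 0#
    coefficient c (just (d , s)) = if does (c ≟ d) then s ◃ 1# else 0#

    coefficient-≡ : ∀ {b} (c : Fin b) s → coefficient c (just (c , s)) ≈ s ◃ 1#
    coefficient-≡ c s with c ≟ c
    ... | yes _   = refl
    ... | no  c≢c = ⊥-elim (c≢c ≡.refl)

    coefficient-≢ : ∀ {b} (c : Fin b) l → (∀ s → l ≢ just (c , s)) → coefficient c l ≈ 0#
    coefficient-≢ c nothing        _ = refl
    coefficient-≢ c (just (d , s)) ≢ with c ≟ d
    ... | yes ≡.refl = ⊥-elim (≢ s ≡.refl)
    ... | no  _      = refl

    coefficient-opposite : ∀ {b} (c : Fin b) l → coefficient c (scale Sign.- l) + coefficient c l ≈ 0#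
    coefficient-opposite c nothing = +-identityˡ 0#
    coefficient-opposite c (just (d , s)) with does (c ≟ d)
    ... | true  = trans (+-congʳ (opposite-◃ s 1#)) (-‿inverseˡ (s ◃ 1#))
    ... | false = +-identityˡ 0#

    -- The coordinate of class `c` kills every old column. On the new one it is plus or minus 2 if
    -- both ends carry the same label, and plus or minus 1 if only `u` belongs to the class.
    independent-potential : ∀ {L b} (Λ : Labelling L b) → let open Labelling Λ in
      ∀ {e u v} c s → Joins e u v → label u ≡ just (c , s) → label v ≡ just (c , s) ⊎ (∀ t → label v ≢ just (c , t)) →
      ∃[ y ] (∀ {f} → f ∈ˡ L → endSum y f ≈ 0#) × endSum y e # 0#
    independent-potential {L} Λ {e} {u} {v} c s j lu lv =
      y , y≈0 , #-congʳ (sym (endSum-joins j y)) (apart lv)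
      where
      open Labelling Λ
      open HeytingProperties heytingCommutativeRing using (#-congʳ; 1#0)

      y : V → Carrier
      y = coefficient c ∘ label

      y≈0 : ∀ {f} → f ∈ˡ L → endSum y f ≈ 0#
      y≈0 {f} f∈L = trans (+-congʳ (reflexive (≡.cong (coefficient c) (opposite-ends f∈L))))
        (coefficient-opposite c (label (proj₂ (ends f))))

      y-s : ∀ {v} → label v ≡ just (c , s) → y v ≈ s ◃ 1#
      y-s eq = trans (reflexive (≡.cong (coefficient c) eq)) (coefficient-≡ c s)

      apart : label v ≡ just (c , s) ⊎ (∀ t → label v ≢ just (c , t)) → y u + y v # 0#
      apart (inj₁ lv) = #-congʳ (sym (trans (+-cong (y-s lu) (y-s lv)) (sym (◃-distrib-+ s 1# 1#)))) (◃-#0 s 2#0)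
      apart (inj₂ lv) = #-congʳ (sym (trans (+-cong (y-s lu) (coefficient-≢ c (label v) lv)) (+-identityʳ _))) (◃-#0 s 1#0)

    -- The count is kept additively: a dependent edge raises `k` and the length together, an
    -- independent one raises the length and lowers `b`. Uniqueness of `L` makes each inserted edge
    -- new.
    labelled-basis : ∀ L → Unique L → ∃[ b ] Labelling L b ×
      ∃[ k ] k ℕ.+ #V ≡ length L ℕ.+ b × ∃[ β ] IsBasisOf {k} β (Circulation L)
    labelled-basis [] _ = #V , initial , 0 , ≡.refl , (λ ()) , (λ ()) , (λ _ _ ()) ,
      λ x (outside , _) → (λ ()) , λ e → outside λ ()
    labelled-basis (e ∷ L) (e≢ ∷ unique) with labelled-basis L unique
    ... | b , Λ , k , eq , β , isBasis with attach L e b Λ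
    ...   | dependent opp = b , extend Λ opp , ℕ.suc k , ≡.cong ℕ.suc eq ,
      basis-extend {b = β} (λ e∈L → All.lookup e≢ e∈L ≡.refl) (dependent-represents Λ opp) isBasis
    ...   | independent {b′} c s j lu lv Λ′ = b′ , Λ′ , k , ≡.trans eq (ℕₚ.+-suc (length L) b′) , β ,
      basis-keep {b = β} (independent-potential Λ c s j lu lv) isBasis

-- Counting edges and bipartite components.

lookup-injective : ∀ {A : Set} {xs : List A} → Unique xs → ∀ i j → lookupˡ xs i ≡ lookupˡ xs j → i ≡ j
lookup-injective (_ ∷ _)  zero    zero    _  = ≡.refl
lookup-injective {xs = x ∷ xs} (x∉ ∷ _) zero (suc j) eq = ⊥-elim (All.lookup x∉ (∈-lookup j) eq)
lookup-injective {xs = x ∷ xs} (x∉ ∷ _) (suc i) zero eq = ⊥-elim (All.lookup x∉ (∈-lookup i) (≡.sym eq))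
lookup-injective (_ ∷ u)  (suc i) (suc j) eq = ≡.cong suc (lookup-injective u i j eq)

module Cardinalities (G : Graph) {F : Pred (Graph.E G) 0ℓ} {L : List (Graph.E G)}
  (F⇒L : ∀ {e} → e ∈ F → e ∈ˡ L) (L⇒F : ∀ {e} → e ∈ˡ L → e ∈ F) where
  open Graph G
  open ComponentLabels G

  edges-cardinality : Unique L → HasCardinality (edgeSetoid G F) (length L)
  edges-cardinality unique = record
    { to        = λ (_ , e∈F) → index (F⇒L e∈F)
    ; from      = λ i → lookupˡ L i , L⇒F (∈-lookup i)
    ; to-cong   = λ {(e , e∈F)} {(f , f∈F)} e≡f → lookup-injective unique _ _
        (≡.trans (≡.sym (lookup-index (F⇒L e∈F))) (≡.trans e≡f (lookup-index (F⇒L f∈F))))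
    ; from-cong = ≡.cong (lookupˡ L)
    ; inverse   =
        (λ {i} {(e , e∈F)} e≡ → lookup-injective unique _ _ (≡.trans (≡.sym (lookup-index (F⇒L e∈F))) e≡)) ,
        (λ {(e , e∈F)} i≡ → ≡.trans (≡.cong (lookupˡ L) i≡) (≡.sym (lookup-index (F⇒L e∈F))))
    }

  walk⇒reachable : ∀ {u v s} → SignedWalk L u v s → Reachable G F u v
  walk⇒reachable []                  = ε
  walk⇒reachable ((e , e∈L , j) ∷ p) = fwd (e , L⇒F e∈L , j) ◅ walk⇒reachable p

  flip : Sign → Bool → Bool
  flip Sign.+ x = x
  flip Sign.- x = not x

  walk-side : ∀ {v} ((side , _) : InBipartiteComponent G F v) → ∀ {a b s} → Reachable G F v a →
    SignedWalk L a b s → side b ≡ flip s (side a)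
  walk-side bip reach [] = ≡.refl
  walk-side (side , proper) reach (_∷_ {u} {v} {w} {s} (e , e∈L , j) p) = ≡.trans
    (walk-side (side , proper) (reach ◅◅ fwd adjacent ◅ ε) p) (flipped s (proper reach adjacent))
    where
    adjacent : Adjacent G F u v
    adjacent = e , L⇒F e∈L , j

    flipped : ∀ s → side u ≢ side v → flip s (side v) ≡ flip (opposite s) (side u)
    flipped Sign.+ ≢ = ¬-not (≢ ∘ ≡.sym)
    flipped Sign.- ≢ = ≡.sym (¬-not ≢)

  module _ {b} (Λ : Labelling L b) where
    open Labelling Λ

    -- A vertex labelled zero has an odd closed walk, along which a two-coloring of its component
    -- would have to differ from itself at `v`.
    component : ∀ {v} → InBipartiteComponent G F v → ∃[ c ] ∃[ s ] label v ≡ just (c , s)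
    component {v} bip = go (label v) ≡.refl
      where
      go : ∀ l → label v ≡ l → ∃[ c ] ∃[ s ] label v ≡ just (c , s)
      go (just (c , s)) lv = c , s , lv
      go nothing        lv = ⊥-elim (not-¬ ≡.refl
        (walk-side bip ε (≡.subst (Anchor L root v) lv (anchor v))))

    adjacent-label : ∀ {u v} → Adjacent G F u v → label v ≡ scale Sign.- (label u)
    adjacent-label (e , e∈F , j) = opposite-joins label (swap j) (opposite-ends (F⇒L e∈F))

    reachable-label : ∀ {u v c s} → Reachable G F u v → label u ≡ just (c , s) → ∃[ t ] label v ≡ just (c , t)
    reachable-label ε lu = _ , lu
    reachable-label (fwd uv ◅ p) lu =
      reachable-label p (≡.trans (adjacent-label uv) (≡.cong (scale Sign.-) lu))
    reachable-label (bwd vu ◅ p) lu =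
      reachable-label p (≡.trans (scale-selfInverse (adjacent-label vu)) (≡.cong (scale Sign.-) lu))

    same-component : ∀ {u v c d s t} → Reachable G F u v → label u ≡ just (c , s) → label v ≡ just (d , t) → c ≡ d
    same-component p lu lv with reachable-label p lu
    ... | _ , lv′ = ≡.cong proj₁ (just-injective (≡.trans (≡.sym lv′) lv))

    -- The signs of the labels provide the two sides, as adjacent vertices have opposite labels.
    root-bipartite : ∀ c → InBipartiteComponent G F (root c)
    root-bipartite c = side ∘ label , proper
      where
      side : Label b → Bool
      -- An arbitrary default: every vertex reachable from the root carries class `c`.
      side nothing             = true
      side (just (_ , Sign.+)) = true
      side (just (_ , Sign.-)) = false

      side-opposite : ∀ d s → side (just (d , s)) ≢ side (scale Sign.- (just (d , s)))
      side-opposite d Sign.+ ()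
      side-opposite d Sign.- ()

      proper : ∀ {u w} → Reachable G F (root c) u → Adjacent G F u w → side (label u) ≢ side (label w)
      proper {u} p uw with reachable-label p (label-root c)
      ... | s , lu rewrite adjacent-label uw | lu = side-opposite c s

    -- Classes are constant under reachability, and the anchor of a vertex connects it with the root
    -- of its class, so classes and bipartite components correspond.
    components-cardinality : HasCardinality (bipartiteComponents G F) b
    components-cardinality = record
      { to        = λ (_ , bip) → proj₁ (component bip)
      ; from      = λ c → root c , root-bipartite c
      ; to-cong   = λ {(_ , bip)} {(_ , bip′)} p →
          same-component p (proj₂ (proj₂ (component bip))) (proj₂ (proj₂ (component bip′)))
      ; from-cong = λ { ≡.refl → ε }
      ; inverse   =
          (λ {c} {(_ , bip)} p → ≡.sym (same-component (EqClosure.symmetric _ p) (label-root c) (proj₂ (proj₂ (component bip))))) ,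
          (λ {(v , bip)} → λ { ≡.refl → EqClosure.symmetric _ (walk⇒reachable
            (≡.subst (Anchor L root v) (proj₂ (proj₂ (component bip))) (anchor v))) })
      }

-- The edge set of the theorem and the final count.

open ℤ using (+_; _+_; _-_)

dimension-identity : ∀ k n l b → k ℕ.+ n ≡ l ℕ.+ b → + k ≡ + l - + n + + b
dimension-identity k n l b eq = begin
  + k                  ≡⟨ //-rightDividesʳ (+ n) (+ k) ⟨
  + (k ℕ.+ n) - + n    ≡⟨ ≡.cong (λ i → + i - + n) eq ⟩
  + (l ℕ.+ b) - + n    ≡⟨ xy∙z≈xz∙y (+ l) (+ b) (ℤ.- + n) ⟩
  + l - + n + + b      ∎
  where
  open ≡.≡-Reasoning
  open GroupProperties (AbelianGroup.group ℤₚ.+-0-abelianGroup) using (//-rightDividesʳ)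
  open CommutativeSemigroupProperties (AbelianGroup.commutativeSemigroup ℤₚ.+-0-abelianGroup)
    using (xy∙z≈xz∙y)

module OnClosedAlternatingWalks {c ℓ₁ ℓ₂ ℓ₃} (ℝ : RealNumbers c ℓ₁ ℓ₂ ℓ₃) (G : Graph)
  (C : Coloring G) (d : Graph.V G → ℕ) (C∈𝒦 : C ∈ 𝒦 G d) where
  open Graph G
  open AlternatingCone ℝ G
  open AlternatingWalks G C using (OnCAW)

  L : List E
  L = filter (E-of? C∈𝒦) (allFin #E)

  L-unique : Unique L
  L-unique = Uniqueₚ.filter⁺ (E-of? C∈𝒦) (Uniqueₚ.allFin⁺ #E)

  E-of⇒L : ∀ {e} → e ∈ E-of G d → e ∈ˡ L
  E-of⇒L {e} = ∈-filter⁺ (E-of? C∈𝒦) (∈-allFin e)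

  L⇒E-of : ∀ {e} → e ∈ˡ L → e ∈ E-of G d
  L⇒E-of e∈L = proj₂ (∈-filter⁻ (E-of? C∈𝒦) {xs = allFin #E} e∈L)

  -- The given closed walk may belong to another coloring with the same red degrees; it still rules
  -- out a cut of `C`, so the dichotomy yields a walk of `C` itself.
  L⇒onCAW : ∀ {e} → e ∈ˡ L → OnCAW e
  L⇒onCAW {e} e∈L with dichotomy C e
  ... | inj₁ onCAW = onCAW
  ... | inj₂ cut   = ⊥-elim (E-of⇒¬cut C∈𝒦 (L⇒E-of e∈L) cut)

  ¬L⇒cut : ∀ {e} → e ∉ˡ L → Cut C e
  ¬L⇒cut {e} e∉L with dichotomy C e
  ... | inj₁ onCAW = ⊥-elim (e∉L (E-of⇒L (C , C∈𝒦 , onCAW)))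
  ... | inj₂ cut   = cut

theorem2p6 : ∀ {c ℓ₁ ℓ₂ ℓ₃} (ℝ : RealNumbers c ℓ₁ ℓ₂ ℓ₃) (G : Graph)
    (C : Coloring G) (d : Graph.V G → ℕ) → C ∈ 𝒦 G d →
    ∃[ dim ] ∃[ #Ed ] ∃[ b ]
    Dimension.HasDimension ℝ (𝒜 G ℝ C) dim ×
    HasCardinality (edgeSetoid G (E-of G d)) #Ed ×
    HasCardinality (bipartiteComponents G (E-of G d)) b ×
    + dim ≡ + #Ed - + Graph.#V G + + b
theorem2p6 ℝ G C d C∈𝒦 =
  let open AlternatingCone ℝ G
      open OnClosedAlternatingWalks ℝ G C d C∈𝒦
      open Cardinalities G E-of⇒L L⇒E-of
      b , Λ , k , eq , β , β∈ , β-independent , β-spanning = labelled-basis C L L-unique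
  in k , length L , b ,
    (β , (λ i → circulation⇒span C L⇒onCAW (β∈ i)) , β-independent ,
      λ x x∈ → β-spanning x (span⇒circulation C ¬L⇒cut x∈)) ,
    edges-cardinality L-unique ,
    components-cardinality Λ ,
    dimension-identity k (Graph.#V G) (length L) b eq
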